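{- Let $n$ be a positive integer. The set of all ordered multiplicity lists attained by matrices in $\mathcal{S}_L(K_n)$ is exactly the set of lists $(m_1, \ldots, m_q)$ of positive integers (of any length $q$) with $m_1 = 1$ and $m_1 + \cdots + m_q = n$.
   Context: Graphs are finite and simple; $K_n$ is the complete graph on $n$ vertices. For a graph $G$ on $n$ vertices, $\mathcal{S}_L(G)$ denotes the set of $n\times n$ real symmetric matrices $A=[a_{i,j}]$ such that $a_{i,j}<0$ if $\{i,j\}\in E(G)$, $a_{i,j}=0$ if $i\neq j$ and $\{i,j\}\notin E(G)$, and $a_{i,i}=-\sum_{k\neq i}a_{i,k}$ for all $i$. The ordered multiplicity list of $A\in\mathcal{S}_L(G)$ is $(m_1,\ldots,m_q)$, where $\lambda_1<\lambda_2<\cdots<\lambda_q$ are the distinct eigenvalues of $A$ in increasing order and $m_i$ is the multiplicity of $\lambda_i$. -}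

module Defs where

open import Algebra.Bundles using (CommutativeRing)
import Algebra.Properties.Semiring.Sum as SemiringSum
open import Data.Bool.Base using (if_then_else_)
open import Data.Fin.Base as Fin using (Fin)
open import Data.Fin.Properties using (_≟_)
open import Data.List.Base using (List; length; lookup)
open import Data.Nat.Base using (ℕ)
open import Data.Product.Base using (∃; ∃-syntax; _×_)
open import Data.Vec.Functional using (Vector)
import Data.Vec.Functional.Relation.Binary.Equality.Setoid as VectorEquality
open import Level using (Level; _⊔_; 0ℓ) renaming (suc to lsuc)
open import Relation.Binary.Core using (Rel)
open import Relation.Binary.Definitions using (Symmetric; Irreflexive; Decidable)
open import Relation.Binary.PropositionalEquality using (_≡_; _≢_; ≢-sym)
import Relation.Binary.Construct.StrictToNonStrict as StrictToNonStrict
open import Relation.Binary.Structures using (IsStrictTotalOrder)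
open import Relation.Nullary.Decidable using (does; ¬?)
open import Relation.Nullary.Negation using (¬_)

-- The real numbers, axiomatised classically as a Dedekind-complete ordered
-- field; these axioms determine ℝ up to unique isomorphism. The order is
-- trichotomous, hence equality and < are decidable.
record CompleteOrderedField (c ℓ : Level) : Set (lsuc (c ⊔ ℓ)) where
  field
    commutativeRing : CommutativeRing c ℓ

  open CommutativeRing commutativeRing public

  infix 4 _<_

  field
    _<_                : Rel Carrier ℓ
    isStrictTotalOrder : IsStrictTotalOrder _≈_ _<_
    0≉1                : ¬ (0# ≈ 1#)
    invertible         : ∀ x → ¬ (x ≈ 0#) → ∃[ y ] x * y ≈ 1#
    +-monoˡ-<          : ∀ {x y} z → x < y → x + z < y + z
    *-pos              : ∀ {x y} → 0# < x → 0# < y → 0# < x * y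

  open StrictToNonStrict _≈_ _<_ public using (_≤_)

  IsUpperBound : (Carrier → Set (c ⊔ ℓ)) → Carrier → Set (c ⊔ ℓ)
  IsUpperBound P u = ∀ x → P x → x ≤ u

  field
    supremum : (P : Carrier → Set (c ⊔ ℓ)) → ∃ P → ∃ (IsUpperBound P) →
               ∃[ s ] IsUpperBound P s × (∀ u → IsUpperBound P u → s ≤ u)

record Graph (n : ℕ) : Set₁ where
  field
    Adj    : Rel (Fin n) 0ℓ
    adj?   : Decidable Adj
    sym    : Symmetric Adj
    irrefl : Irreflexive _≡_ Adj

K : (n : ℕ) → Graph n
K n = record
  { Adj    = _≢_
  ; adj?   = λ i j → ¬? (i ≟ j)
  ; sym    = ≢-sym
  ; irrefl = λ i≡j i≢j → i≢j i≡j
  }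

module Spectral {c ℓ : Level} (ℝ : CompleteOrderedField c ℓ) where

  open CompleteOrderedField ℝ
  open SemiringSum semiring using (sum-syntax)
  open VectorEquality setoid using (_≋_)

  Matrix : ℕ → Set c
  Matrix n = Vector (Vector Carrier n) n

  0ᵛ : ∀ {n} → Vector Carrier n
  0ᵛ _ = 0#

  infixr 7 _*ᵛ_ _·_

  _*ᵛ_ : ∀ {n} → Carrier → Vector Carrier n → Vector Carrier n
  (a *ᵛ x) i = a * x i

  _·_ : ∀ {n} → Matrix n → Vector Carrier n → Vector Carrier n
  _·_ {n} A x i = ∑[ j < n ] (A i j * x j)

  linComb : ∀ {m n} → Vector Carrier m → Vector (Vector Carrier n) m →
            Vector Carrier n
  linComb {m} a v i = ∑[ k < m ] (a k * v k i)

  LinearlyIndependent : ∀ {m n} → Vector (Vector Carrier n) m → Set (c ⊔ ℓ)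
  LinearlyIndependent v = ∀ a → linComb a v ≋ 0ᵛ → a ≋ 0ᵛ

  -- Intended for predicates W that are linear subspaces.
  record HasDimension {n : ℕ} (W : Vector Carrier n → Set ℓ) (m : ℕ) :
                      Set (c ⊔ ℓ) where
    field
      basis       : Vector (Vector Carrier n) m
      inW         : ∀ k → W (basis k)
      independent : LinearlyIndependent basis
      spanning    : ∀ x → W x → ∃[ a ] x ≋ linComb a basis

  InEigenspace : ∀ {n} → Matrix n → Carrier → Vector Carrier n → Set ℓ
  InEigenspace A μ x = A · x ≋ μ *ᵛ x

  IsEigenvalue : ∀ {n} → Matrix n → Carrier → Set (c ⊔ ℓ)
  IsEigenvalue A μ = ∃[ x ] ¬ (x ≋ 0ᵛ) × InEigenspace A μ x

  -- For the symmetric matrices considered here, geometric and algebraic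
  -- multiplicity agree.
  HasMultiplicity : ∀ {n} → Matrix n → Carrier → ℕ → Set (c ⊔ ℓ)
  HasMultiplicity A μ m = HasDimension (InEigenspace A μ) m

  record IsOrderedMultiplicityList {n : ℕ} (A : Matrix n) (ms : List ℕ) :
                                   Set (c ⊔ ℓ) where
    field
      eigenvalue     : Vector Carrier (length ms)
      increasing     : ∀ {i j} → i Fin.< j → eigenvalue i < eigenvalue j
      isEigenvalue   : ∀ i → IsEigenvalue A (eigenvalue i)
      allEigenvalues : ∀ μ → IsEigenvalue A μ → ∃[ i ] μ ≈ eigenvalue i
      multiplicity   : ∀ i → HasMultiplicity A (eigenvalue i) (lookup ms i)

  record 𝓢ᴸ {n : ℕ} (G : Graph n) (A : Matrix n) : Set ℓ where
    open Graph G using (Adj)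
    field
      symmetric : ∀ i j → A i j ≈ A j i
      edge      : ∀ i j → Adj i j → A i j < 0#
      nonEdge   : ∀ i j → i ≢ j → ¬ Adj i j → A i j ≈ 0#
      diagonal  : ∀ i → A i i ≈
                  - (∑[ k < n ] (if does (k ≟ i) then 0# else A i k))

  Attains : ∀ {n} → Graph n → List ℕ → Set (c ⊔ ℓ)
  Attains G ms = ∃[ A ] 𝓢ᴸ G A × IsOrderedMultiplicityList A ms

{-# OPTIONS --safe #-}

-- Let A be a Laplacian of Kₙ. Its quadratic form is a positively weighted sum of
-- the squares (xᵢ − xⱼ)², so 0 is its least eigenvalue, with the constants as
-- eigenspace. Bases of the eigenspaces are jointly independent, so the
-- multiplicities add up to at most n; if they did not span, the infimum of the
-- Rayleigh quotient on the orthogonal complement of their span would be an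
-- eigenvalue with an eigenvector outside all eigenspaces.
--
-- Conversely, start from a single vertex and treat the multiplicities from the
-- last to the second: for a multiplicity m, join m new vertices to each other and
-- to everything else with edges of a common weight. This creates one new
-- eigenvalue of multiplicity m, which lies below the other nonzero ones if these
-- were large enough at the start.
module Submission where

open import Defs
open import Algebra.Bundles using (RawRing)
import Algebra.Properties.AbelianGroup as AbelianGroupProperties
import Algebra.Properties.CommutativeSemigroup as CommutativeSemigroupProperties
import Algebra.Properties.Ring as RingProperties
import Algebra.Properties.Semiring.Mult.TCOptimised as SemiringMult
import Algebra.Properties.Semiring.Sum as SemiringSum
import Algebra.Solver.Ring as RingSolver
open import Algebra.Solver.Ring.AlmostCommutativeRing
  using (fromCommutativeRing; _-Raw-AlmostCommutative⟶_)
open import Data.Bool.Base using (if_then_else_)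
open import Data.Fin.Base as Fin using (Fin; zero; suc; _↑ˡ_; _↑ʳ_; splitAt; punchIn)
open import Data.Fin.Properties as Finₚ using (any?; punchInᵢ≢i; splitAt-↑ˡ; splitAt-↑ʳ)
open import Data.List.Base as List using (List; []; _∷_; length; lookup)
open import Data.List.Membership.Propositional.Properties using (∈-lookup)
open import Data.List.Relation.Unary.All as All using (All)
open import Data.List.Relation.Unary.Any using (index)
open import Data.List.Relation.Unary.Any.Properties using (lookup-index)
open import Data.Maybe.Base using (Maybe; just; nothing)
open import Data.Nat.Base as ℕ using (ℕ; zero; suc; s≤s)
import Data.Nat.ListAction as ListAction
import Data.Nat.Properties as ℕₚ
open import Data.Product.Base using (∃; ∃-syntax; _×_; _,_; proj₁; proj₂)
open import Data.Sum.Base using (_⊎_; inj₁; inj₂; [_,_]′)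
open import Data.Vec.Functional using (Vector; insertAt; removeAt; tail; _++_)
  renaming (_∷_ to infixr 5 _∷ᵛ_)
import Data.Vec.Functional.Properties as Vecₚ
import Data.Vec.Functional.Relation.Binary.Equality.Setoid as VectorEquality
open import Function.Base using (_∘_; flip)
open import Function.Bundles using (_⇔_; mk⇔)
open import Level using (Level; _⊔_)
open import Relation.Binary.Bundles using (StrictPartialOrder)
open import Relation.Binary.Definitions using (tri<; tri≈; tri>)
import Relation.Binary.Reasoning.StrictPartialOrder as StrictPartialOrderReasoning
open import Relation.Binary.PropositionalEquality as ≡ using (_≡_; _≢_)
open import Relation.Binary.Structures using (IsStrictTotalOrder)
open import Relation.Nullary.Decidable
  using (yes; no; does; ¬?; dec-true; dec-false; decidable-stable)
open import Relation.Nullary.Negation using (¬_; contradiction)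

-- That the infimum of the Rayleigh quotient is attained is not a compactness argument here. It
-- rests on one fact of linear algebra, that more vectors than coordinates are dependent, applied to
-- a bordered matrix: either the form degenerates on the complement, or every coordinate functional
-- is represented by the form there. In the second case the form dominates a positive multiple of
-- the squared norm. In the converse the order of the eigenvalues is the delicate point. With `N`
-- old vertices the new eigenvalue is `(m + N) w`, while an old nonzero eigenvalue `μ` becomes
-- `μ + m w`; so the new one comes first exactly when `μ` exceeds `N w`. The construction therefore
-- carries a lower bound `b` for all nonzero eigenvalues: a demand `b` on the larger graph, met with
-- `w = 1 + b`, turns into the demand `N (1 + b)` on the smaller one. Completeness of the resulting
-- list needs no separate computation, because independent eigenvectors in total number `n` leave no
-- room for others.

module CompleteGraph {c ℓ : Level} (ℝ : CompleteOrderedField c ℓ) where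

  open CompleteOrderedField ℝ hiding (zero)
  open Spectral ℝ
  open IsStrictTotalOrder isStrictTotalOrder
    using (compare; _≟_; irrefl; asym; isStrictPartialOrder)
    renaming (trans to <-trans; <-respʳ-≈ to <-respʳ; <-respˡ-≈ to <-respˡ)
  open RingProperties ring using (-‿distribˡ-*; -‿distribʳ-*)
  open AbelianGroupProperties +-abelianGroup using (⁻¹-∙-comm; ε⁻¹≈ε)
  open CommutativeSemigroupProperties +-commutativeSemigroup using (interchange)
  open SemiringSum semiring
  open VectorEquality setoid using (_≋_)
  private module Mult = SemiringMult semiring

  -- Order reasoning, and a solver for ring identities with integer coefficients.

  strictPartialOrder : StrictPartialOrder c ℓ ℓ
  strictPartialOrder = record { isStrictPartialOrder = isStrictPartialOrder }

  module ≤-Reasoning = StrictPartialOrderReasoning strictPartialOrder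
  open ≤-Reasoning

  -- The pair (a , b) stands for the integer a − b; the normalising clauses of
  -- the valuation make the literals 0 and 1 denote 0# and 1# on the nose.
  -- Pairs are kept reduced because the solver compares coefficients syntactically.
  normalise : ℕ × ℕ → ℕ × ℕ
  normalise (a , b) = a ℕ.∸ b , b ℕ.∸ a

  Coefficients : RawRing _ _
  Coefficients = record
    { Carrier = ℕ × ℕ
    ; _≈_     = _≡_
    ; _+_     = λ (a , b) (c , d) → normalise (a ℕ.+ c , b ℕ.+ d)
    ; _*_     = λ (a , b) (c , d) → normalise (a ℕ.* c ℕ.+ b ℕ.* d , a ℕ.* d ℕ.+ b ℕ.* c)
    ; -_      = λ (a , b) → b , a
    ; 0#      = 0 , 0
    ; 1#      = 1 , 0
    }

  private
    -- With this version of the multiple, `ι 1` reduces to `1#`, not to a sum with `0#`.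
    ι : ℕ → Carrier
    ι n = n Mult.× 1#

    ⟦_⟧ : ℕ × ℕ → Carrier
    ⟦ a , zero ⟧  = ι a
    ⟦ a , suc b ⟧ = ι a - ι (suc b)

    ⟦⟧-difference : ∀ a b → ⟦ a , b ⟧ ≈ ι a - ι b
    ⟦⟧-difference a zero = sym (trans (+-congˡ ε⁻¹≈ε) (+-identityʳ _))
    ⟦⟧-difference a (suc b) = refl

    cancel : ∀ x y z → (x + z) - (y + z) ≈ x - y
    cancel x y z = begin-equality
      (x + z) - (y + z)   ≈⟨ +-congˡ (⁻¹-∙-comm _ _) ⟨
      (x + z) + (- y - z) ≈⟨ interchange _ _ _ _ ⟩
      (x - y) + (z - z)   ≈⟨ +-congˡ (-‿inverseʳ z) ⟩
      (x - y) + 0#        ≈⟨ +-identityʳ _ ⟩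
      x - y               ∎

    ⟦normalise⟧ : ∀ a b → ⟦ normalise (a , b) ⟧ ≈ ι a - ι b
    ⟦normalise⟧ zero    zero    = ⟦⟧-difference 0 0
    ⟦normalise⟧ zero    (suc b) = refl
    ⟦normalise⟧ (suc a) zero    = ⟦⟧-difference (suc a) 0
    ⟦normalise⟧ (suc a) (suc b) = begin-equality
      ⟦ normalise (a , b) ⟧     ≈⟨ ⟦normalise⟧ a b ⟩
      ι a - ι b                 ≈⟨ cancel (ι a) (ι b) 1# ⟨
      (ι a + 1#) - (ι b + 1#)   ≈⟨ +-cong (ι-suc a) (-‿cong (ι-suc b)) ⟨
      ι (suc a) - ι (suc b)     ∎
      where
      ι-suc : ∀ n → ι (suc n) ≈ ι n + 1#
      ι-suc n = trans (Mult.×-homo-+ 1# 1 n) (+-comm 1# (ι n))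

    -- Calculated by hand, since the solver is only available once this identity is known.
    *-difference : ∀ a b c d → (a * c + b * d) - (a * d + b * c) ≈ (a - b) * (c - d)
    *-difference a b c d = begin-equality
      (a * c + b * d) - (a * d + b * c)         ≈⟨ +-congˡ (⁻¹-∙-comm _ _) ⟨
      (a * c + b * d) + (- (a * d) + - (b * c)) ≈⟨ interchange _ _ _ _ ⟩
      (a * c - a * d) + (b * d - b * c)         ≈⟨ +-cong (+-congˡ (-‿distribʳ-* a d)) (+-comm _ _) ⟩
      (a * c + a * - d) + (- (b * c) + b * d)   ≈⟨ +-cong (sym (distribˡ _ _ _)) (+-cong (-‿distribˡ-* b c) b*d) ⟩
      a * (c - d) + (- b * c + - b * - d)       ≈⟨ +-congˡ (sym (distribˡ _ _ _)) ⟩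
      a * (c - d) + - b * (c - d)               ≈⟨ distribʳ _ _ _ ⟨
      (a - b) * (c - d)                         ∎
      where
      b*d : b * d ≈ - b * - d
      b*d = begin-equality
        b * d       ≈⟨ AbelianGroupProperties.⁻¹-involutive +-abelianGroup _ ⟨
        - - (b * d) ≈⟨ -‿cong (-‿distribˡ-* b d) ⟩
        - (- b * d) ≈⟨ -‿distribʳ-* (- b) d ⟩
        - b * - d   ∎

    coefficientMorphism : Coefficients -Raw-AlmostCommutative⟶ fromCommutativeRing commutativeRing
    coefficientMorphism = record
      { ⟦_⟧    = ⟦_⟧
      ; +-homo = λ (a , b) (c , d) → begin-equality
          ⟦ normalise (a ℕ.+ c , b ℕ.+ d) ⟧ ≈⟨ ⟦normalise⟧ (a ℕ.+ c) (b ℕ.+ d) ⟩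
          ι (a ℕ.+ c) - ι (b ℕ.+ d)   ≈⟨ +-cong (Mult.×-homo-+ 1# a c) (-‿cong (Mult.×-homo-+ 1# b d)) ⟩
          (ι a + ι c) - (ι b + ι d)   ≈⟨ +-congˡ (⁻¹-∙-comm _ _) ⟨
          (ι a + ι c) + (- ι b - ι d) ≈⟨ interchange _ _ _ _ ⟩
          (ι a - ι b) + (ι c - ι d)   ≈⟨ +-cong (⟦⟧-difference a b) (⟦⟧-difference c d) ⟨
          ⟦ a , b ⟧ + ⟦ c , d ⟧       ∎
      ; *-homo = λ (a , b) (c , d) → begin-equality
          ⟦ normalise (a ℕ.* c ℕ.+ b ℕ.* d , a ℕ.* d ℕ.+ b ℕ.* c) ⟧
            ≈⟨ ⟦normalise⟧ (a ℕ.* c ℕ.+ b ℕ.* d) (a ℕ.* d ℕ.+ b ℕ.* c) ⟩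
          ι (a ℕ.* c ℕ.+ b ℕ.* d) - ι (a ℕ.* d ℕ.+ b ℕ.* c)
            ≈⟨ +-cong (ι-homo a c b d) (-‿cong (ι-homo a d b c)) ⟩
          (ι a * ι c + ι b * ι d) - (ι a * ι d + ι b * ι c) ≈⟨ *-difference _ _ _ _ ⟩
          (ι a - ι b) * (ι c - ι d)   ≈⟨ *-cong (⟦⟧-difference a b) (⟦⟧-difference c d) ⟨
          ⟦ a , b ⟧ * ⟦ c , d ⟧       ∎
      ; -‿homo = λ (a , b) → begin-equality
          ⟦ b , a ⟧     ≈⟨ ⟦⟧-difference b a ⟩
          ι b - ι a     ≈⟨ AbelianGroupProperties.⁻¹-anti-homo‿- +-abelianGroup _ _ ⟨
          - (ι a - ι b) ≈⟨ -‿cong (⟦⟧-difference a b) ⟨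
          - ⟦ a , b ⟧   ∎
      ; 0-homo = refl
      ; 1-homo = refl
      }
      where
      ι-homo : ∀ a b c d → ι (a ℕ.* b ℕ.+ c ℕ.* d) ≈ ι a * ι b + ι c * ι d
      ι-homo a b c d = trans (Mult.×-homo-+ 1# (a ℕ.* b) (c ℕ.* d)) (+-cong (Mult.×1-homo-* a b) (Mult.×1-homo-* c d))

    -- Differences are compared by cross sums in the natural numbers, so no subtraction is involved.
    coefficient≟ : (x y : ℕ × ℕ) → Maybe (⟦ x ⟧ ≈ ⟦ y ⟧)
    coefficient≟ (a , b) (c , d) with a ℕ.+ d ℕₚ.≟ c ℕ.+ b
    ... | no  _       = nothing
    ... | yes a+d≡c+b = just (begin-equality
      ⟦ a , b ⟧                 ≈⟨ ⟦⟧-difference a b ⟩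
      ι a - ι b                 ≈⟨ cancel (ι a) (ι b) (ι d) ⟨
      (ι a + ι d) - (ι b + ι d) ≈⟨ +-congʳ (trans (sym (Mult.×-homo-+ 1# a d))
                                             (trans (reflexive (≡.cong ι a+d≡c+b)) (Mult.×-homo-+ 1# c b))) ⟩
      (ι c + ι b) - (ι b + ι d) ≈⟨ +-congˡ (-‿cong (+-comm _ _)) ⟩
      (ι c + ι b) - (ι d + ι b) ≈⟨ cancel (ι c) (ι d) (ι b) ⟩
      ι c - ι d                 ≈⟨ ⟦⟧-difference c d ⟨
      ⟦ c , d ⟧                 ∎)

  open RingSolver Coefficients (fromCommutativeRing commutativeRing) coefficientMorphism coefficient≟
    using (solve; con; _:+_; _:*_; _:-_; :-_; _:=_; Polynomial)

  :0 :1 : ∀ {n} → Polynomial n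
  :0 = con (0 , 0)
  :1 = con (1 , 0)

  -- Arithmetic in the ordered field.

  ≤-refl : ∀ {x} → x ≤ x
  ≤-refl = inj₂ refl

  <⇒≱ : ∀ {x y} → x < y → ¬ (y ≤ x)
  <⇒≱ x<y (inj₁ y<x) = asym x<y y<x
  <⇒≱ x<y (inj₂ y≈x) = irrefl (sym y≈x) x<y

  ≮⇒≥ : ∀ {x y} → ¬ (x < y) → y ≤ x
  ≮⇒≥ {x} {y} x≮y with compare x y
  ... | tri< x<y _ _ = contradiction x<y x≮y
  ... | tri≈ _ x≈y _ = inj₂ (sym x≈y)
  ... | tri> _ _ y<x = inj₁ y<x

  ≤-antisym : ∀ {x y} → x ≤ y → y ≤ x → x ≈ y
  ≤-antisym x≤y (inj₁ y<x) = contradiction x≤y (<⇒≱ y<x)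
  ≤-antisym x≤y (inj₂ y≈x) = sym y≈x

  ≤-respʳ : ∀ {x y z} → y ≈ z → x ≤ y → x ≤ z
  ≤-respʳ y≈z (inj₁ x<y) = inj₁ (<-respʳ y≈z x<y)
  ≤-respʳ y≈z (inj₂ x≈y) = inj₂ (trans x≈y y≈z)

  x<y⇒0<y-x : ∀ {x y} → x < y → 0# < y - x
  x<y⇒0<y-x {x} {y} x<y = <-respˡ (-‿inverseʳ x) (+-monoˡ-< (- x) x<y)

  x≤y⇒0≤y-x : ∀ {x y} → x ≤ y → 0# ≤ y - x
  x≤y⇒0≤y-x (inj₁ x<y) = inj₁ (x<y⇒0<y-x x<y)
  x≤y⇒0≤y-x (inj₂ x≈y) = inj₂ (sym (trans (+-congʳ (sym x≈y)) (-‿inverseʳ _)))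

  0<y-x⇒x<y : ∀ {x y} → 0# < y - x → x < y
  0<y-x⇒x<y {x} {y} 0<y-x = <-respʳ (solve 2 (λ x y → (y :- x) :+ x := y) refl x y)
                              (<-respˡ (+-identityˡ x) (+-monoˡ-< x 0<y-x))

  0≤y-x⇒x≤y : ∀ {x y} → 0# ≤ y - x → x ≤ y
  0≤y-x⇒x≤y (inj₁ 0<y-x) = inj₁ (0<y-x⇒x<y 0<y-x)
  0≤y-x⇒x≤y {x} {y} (inj₂ 0≈y-x) = inj₂ (begin-equality
    x           ≈⟨ +-identityˡ x ⟨
    0# + x      ≈⟨ +-congʳ 0≈y-x ⟩
    (y - x) + x ≈⟨ solve 2 (λ x y → (y :- x) :+ x := y) refl x y ⟩
    y           ∎)

  <-+-≤ : ∀ {x y} → 0# < x → 0# ≤ y → 0# < x + y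
  <-+-≤ {x} {y} 0<x 0≤y = begin-strict
    0#     ≤⟨ 0≤y ⟩
    y      ≈⟨ +-identityˡ y ⟨
    0# + y <⟨ +-monoˡ-< y 0<x ⟩
    x + y  ∎

  +-nonneg : ∀ {x y} → 0# ≤ x → 0# ≤ y → 0# ≤ x + y
  +-nonneg (inj₁ 0<x) 0≤y = inj₁ (<-+-≤ 0<x 0≤y)
  +-nonneg {x} {y} (inj₂ 0≈x) 0≤y = ≤-respʳ (trans (sym (+-identityˡ y)) (+-congʳ 0≈x)) 0≤y

  *-nonneg : ∀ {x y} → 0# ≤ x → 0# ≤ y → 0# ≤ x * y
  *-nonneg (inj₁ 0<x) (inj₁ 0<y) = inj₁ (*-pos 0<x 0<y)
  *-nonneg {x} (inj₁ 0<x) (inj₂ 0≈y) = inj₂ (trans (sym (zeroʳ x)) (*-congˡ 0≈y))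
  *-nonneg {x} {y} (inj₂ 0≈x) _      = inj₂ (trans (sym (zeroˡ y)) (*-congʳ 0≈x))

  x<0⇒0<-x : ∀ {x} → x < 0# → 0# < - x
  x<0⇒0<-x x<0 = <-respʳ (+-identityˡ _) (x<y⇒0<y-x x<0)

  0<x⇒-x<0 : ∀ {x} → 0# < x → - x < 0#
  0<x⇒-x<0 {x} 0<x = 0<y-x⇒x<y (<-respʳ (solve 1 (λ x → x := :0 :- (:- x)) refl x) 0<x)

  square-nonneg : ∀ x → 0# ≤ x * x
  square-nonneg x with compare x 0#
  ... | tri< x<0 _ _ = inj₁ (<-respʳ (solve 1 (λ x → :- x :* :- x := x :* x) refl x)
                               (*-pos (x<0⇒0<-x x<0) (x<0⇒0<-x x<0)))
  ... | tri≈ _ x≈0 _ = *-nonneg (inj₂ (sym x≈0)) (inj₂ (sym x≈0))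
  ... | tri> _ _ 0<x = inj₁ (*-pos 0<x 0<x)

  0<1 : 0# < 1#
  0<1 with square-nonneg 1#
  ... | inj₁ 0<1*1 = <-respʳ (*-identityˡ 1#) 0<1*1
  ... | inj₂ 0≈1*1 = contradiction (trans 0≈1*1 (*-identityˡ 1#)) 0≉1

  *-cancelˡ-≈0 : ∀ {x y} → ¬ (x ≈ 0#) → x * y ≈ 0# → y ≈ 0#
  *-cancelˡ-≈0 {x} {y} x≉0 xy≈0 with invertible x x≉0
  ... | x⁻¹ , xx⁻¹≈1 = begin-equality
    y             ≈⟨ *-identityˡ y ⟨
    1# * y        ≈⟨ *-congʳ xx⁻¹≈1 ⟨
    (x * x⁻¹) * y ≈⟨ solve 3 (λ x x⁻¹ y → (x :* x⁻¹) :* y := x⁻¹ :* (x :* y)) refl x x⁻¹ y ⟩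
    x⁻¹ * (x * y) ≈⟨ *-congˡ xy≈0 ⟩
    x⁻¹ * 0#      ≈⟨ zeroʳ x⁻¹ ⟩
    0#            ∎

  *-cancelˡ-nonneg : ∀ {x y} → 0# < x → 0# ≤ x * y → 0# ≤ y
  *-cancelˡ-nonneg {x} {y} 0<x 0≤xy = ≮⇒≥ λ y<0 →
    <⇒≱ (<-respʳ (solve 2 (λ x y → x :* :- y := :- (x :* y)) refl x y) (*-pos 0<x (x<0⇒0<-x y<0)))
        (0≤y-x⇒x≤y (≤-respʳ (solve 1 (λ z → z := :0 :- (:- z)) refl _) 0≤xy))

  0<x⇒0<x⁻¹ : ∀ {x y} → 0# < x → x * y ≈ 1# → 0# < y
  0<x⇒0<x⁻¹ {x} {y} 0<x xy≈1 with *-cancelˡ-nonneg 0<x (inj₁ (<-respʳ (sym xy≈1) 0<1))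
  ... | inj₁ 0<y = 0<y
  ... | inj₂ 0≈y = contradiction (trans (sym (zeroʳ x)) (trans (*-congˡ 0≈y) xy≈1)) 0≉1

  square≈0⇒≈0 : ∀ {x} → x * x ≈ 0# → x ≈ 0#
  square≈0⇒≈0 {x} xx≈0 = decidable-stable (x ≟ 0#) λ x≉0 → x≉0 (*-cancelˡ-≈0 x≉0 xx≈0)

  x-y≈0⇒x≈y : ∀ {x y} → x - y ≈ 0# → x ≈ y
  x-y≈0⇒x≈y = AbelianGroupProperties.x∙y⁻¹≈ε⇒x≈y +-abelianGroup _ _

  -- Finite sums and their signs.

  sum-zero : ∀ {n} {f : Vector Carrier n} → (∀ i → f i ≈ 0#) → sum f ≈ 0#
  sum-zero {n} f≈0 = trans (sum-cong-≋ f≈0) (sum-replicate-zero n)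

  sum-++ : ∀ m {n} (f : Vector Carrier (m ℕ.+ n)) →
           sum f ≈ sum (λ i → f (i ↑ˡ n)) + sum (λ j → f (m ↑ʳ j))
  sum-++ zero    f = sym (+-identityˡ _)
  sum-++ (suc m) f = trans (+-congˡ (sum-++ m (f ∘ suc))) (sym (+-assoc _ _ _))

  sum-single : ∀ {n} {f : Vector Carrier n} i → (∀ k → k ≢ i → f k ≈ 0#) → sum f ≈ f i
  sum-single {suc n} {f} i f≈0 = begin-equality
    sum f                    ≈⟨ sum-remove f ⟩
    f i + sum (removeAt f i) ≈⟨ +-congˡ (sum-zero λ k → f≈0 _ (punchInᵢ≢i i k)) ⟩
    f i + 0#                 ≈⟨ +-identityʳ _ ⟩
    f i                      ∎

  sum-nonneg : ∀ {n} {f : Vector Carrier n} → (∀ i → 0# ≤ f i) → 0# ≤ sum f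
  sum-nonneg {zero}  0≤f = ≤-refl
  sum-nonneg {suc n} 0≤f = +-nonneg (0≤f zero) (sum-nonneg (0≤f ∘ suc))

  term≤sum : ∀ {n} {f : Vector Carrier n} → (∀ i → 0# ≤ f i) → ∀ i → 0# ≤ sum f - f i
  term≤sum {suc n} {f} 0≤f i = ≤-respʳ
    (begin-equality
      sum (removeAt f i)               ≈⟨ solve 2 (λ x y → y := (x :+ y) :- x) refl (f i) _ ⟩
      (f i + sum (removeAt f i)) - f i ≈⟨ +-congʳ (sum-remove f) ⟨
      sum f - f i                      ∎)
    (sum-nonneg λ k → 0≤f (punchIn i k))

  sum-nonneg-≈0 : ∀ {n} {f : Vector Carrier n} → (∀ i → 0# ≤ f i) → sum f ≈ 0# → ∀ i → f i ≈ 0#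
  sum-nonneg-≈0 {f = f} 0≤f Σf≈0 i = ≤-antisym
    (0≤y-x⇒x≤y (≤-respʳ (+-congʳ Σf≈0) (term≤sum 0≤f i))) (0≤f i)

  -- The dot product.

  infixl 6 _+ᵛ_
  infix 8 _∙_

  _+ᵛ_ : ∀ {n} → Vector Carrier n → Vector Carrier n → Vector Carrier n
  (x +ᵛ y) i = x i + y i

  _∙_ : ∀ {n} → Vector Carrier n → Vector Carrier n → Carrier
  x ∙ y = sum (λ i → x i * y i)

  ∙-cong : ∀ {n} {x x′ y y′ : Vector Carrier n} → x ≋ x′ → y ≋ y′ → x ∙ y ≈ x′ ∙ y′
  ∙-cong x≋x′ y≋y′ = sum-cong-≋ λ i → *-cong (x≋x′ i) (y≋y′ i)

  ∙-congˡ : ∀ {n} (x : Vector Carrier n) {y y′} → y ≋ y′ → x ∙ y ≈ x ∙ y′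
  ∙-congˡ x = ∙-cong (λ _ → refl)

  ∙-comm : ∀ {n} (x y : Vector Carrier n) → x ∙ y ≈ y ∙ x
  ∙-comm x y = sum-cong-≋ λ i → *-comm (x i) (y i)

  ∙-distribˡ : ∀ {n} (x y z : Vector Carrier n) → x ∙ (y +ᵛ z) ≈ x ∙ y + x ∙ z
  ∙-distribˡ x y z = trans (sum-cong-≋ λ i → distribˡ (x i) (y i) (z i))
                           (∑-distrib-+ (λ i → x i * y i) (λ i → x i * z i))

  ∙-*ʳ : ∀ {n} (x : Vector Carrier n) a y → x ∙ (a *ᵛ y) ≈ a * x ∙ y
  ∙-*ʳ x a y = trans (sum-cong-≋ λ i → solve 3 (λ x a y → x :* (a :* y) := a :* (x :* y)) refl (x i) a (y i))
                     (sym (*-distribˡ-sum a (λ i → x i * y i)))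

  ∙-zeroʳ : ∀ {n} (x : Vector Carrier n) → x ∙ 0ᵛ ≈ 0#
  ∙-zeroʳ x = sum-zero λ i → zeroʳ (x i)

  ∙-sum : ∀ {m n} (x : Vector Carrier n) (v : Vector (Vector Carrier n) m) →
          x ∙ (λ i → sum (λ k → v k i)) ≈ sum (λ k → x ∙ v k)
  ∙-sum x v = trans (sum-cong-≋ λ i → *-distribˡ-sum (x i) (λ k → v k i)) (∑-comm (λ i k → x i * v k i))

  ∙-linComb : ∀ {m n} (x : Vector Carrier n) a (v : Vector (Vector Carrier n) m) →
              x ∙ linComb a v ≈ sum (λ k → a k * x ∙ v k)
  ∙-linComb x a v = trans (∙-sum x (λ k → a k *ᵛ v k)) (sum-cong-≋ λ k → ∙-*ʳ x (a k) (v k))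

  ∙-linComb-≈0 : ∀ {m n} (x : Vector Carrier n) a (v : Vector (Vector Carrier n) m) →
                 (∀ k → x ∙ v k ≈ 0#) → x ∙ linComb a v ≈ 0#
  ∙-linComb-≈0 x a v x⊥v = trans (∙-linComb x a v) (sum-zero λ k → trans (*-congˡ (x⊥v k)) (zeroʳ (a k)))

  ∙-nonneg : ∀ {n} (x : Vector Carrier n) → 0# ≤ x ∙ x
  ∙-nonneg x = sum-nonneg λ i → square-nonneg (x i)

  x∙x≈0⇒x≋0 : ∀ {n} {x : Vector Carrier n} → x ∙ x ≈ 0# → x ≋ 0ᵛ
  x∙x≈0⇒x≋0 {x = x} x∙x≈0 i = square≈0⇒≈0 (sum-nonneg-≈0 (λ i → square-nonneg (x i)) x∙x≈0 i)

  nonzeroEntry : ∀ {n} (x : Vector Carrier n) → (∃[ i ] ¬ (x i ≈ 0#)) ⊎ x ≋ 0ᵛ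
  nonzeroEntry x with any? (λ i → ¬? (x i ≟ 0#))
  ... | yes x≉0 = inj₁ x≉0
  ... | no  x≈0 = inj₂ λ i → decidable-stable (x i ≟ 0#) λ xi≉0 → x≈0 (i , xi≉0)

  -- Symmetric matrices and their eigenspaces.

  Symmetric : ∀ {n} → Matrix n → Set ℓ
  Symmetric A = ∀ i j → A i j ≈ A j i

  ·-cong : ∀ {n} (A : Matrix n) {x y} → x ≋ y → A · x ≋ A · y
  ·-cong A x≋y i = ∙-congˡ (A i) x≋y

  ·-linComb : ∀ {m n} (A : Matrix n) a (v : Vector (Vector Carrier n) m) →
              A · linComb a v ≋ linComb a (λ k → A · v k)
  ·-linComb A a v i = ∙-linComb (A i) a v

  ·-adjoint : ∀ {n} {A : Matrix n} → Symmetric A → ∀ x y → x ∙ (A · y) ≈ (A · x) ∙ y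
  ·-adjoint {A = A} A-sym x y = begin-equality
    x ∙ (A · y)                                       ≈⟨ sum-cong-≋ (λ i → *-distribˡ-sum (x i) (λ j → A i j * y j)) ⟩
    sum (λ i → sum (λ j → x i * (A i j * y j)))       ≈⟨ ∑-comm (λ i j → x i * (A i j * y j)) ⟩
    sum (λ j → sum (λ i → x i * (A i j * y j)))       ≈⟨ sum-cong-≋ (λ j → sum-cong-≋ λ i →
      trans (solve 3 (λ x a y → x :* (a :* y) := (a :* x) :* y) refl (x i) (A i j) (y j))
            (*-congʳ (*-congʳ (A-sym i j)))) ⟩
    sum (λ j → sum (λ i → (A j i * x i) * y j))       ≈⟨ sum-cong-≋ (λ j → *-distribʳ-sum (y j) (λ i → A j i * x i)) ⟨
    (A · x) ∙ y                                       ∎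

  inEigenspace-linComb : ∀ {m n} {A : Matrix n} {μ} a (v : Vector (Vector Carrier n) m) →
                         (∀ k → InEigenspace A μ (v k)) → InEigenspace A μ (linComb a v)
  inEigenspace-linComb {A = A} {μ} a v eig i = begin-equality
    (A · linComb a v) i              ≈⟨ ·-linComb A a v i ⟩
    linComb a (λ k → A · v k) i      ≈⟨ sum-cong-≋ (λ k → trans (*-congˡ (eig k i))
      (solve 3 (λ a μ v → a :* (μ :* v) := μ :* (a :* v)) refl (a k) μ (v k i))) ⟩
    sum (λ k → μ * (a k * v k i))    ≈⟨ *-distribˡ-sum μ (λ k → a k * v k i) ⟨
    (μ *ᵛ linComb a v) i             ∎

  -- Moving `A` across the dot product evaluates the same number as `λ₁ * x ∙ y` and as
  -- `λ₂ * x ∙ y`.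
  eigenspaces-orthogonal : ∀ {n} {A : Matrix n} → Symmetric A → ∀ {λ₁ λ₂} → ¬ (λ₁ ≈ λ₂) → ∀ {x y} →
                           InEigenspace A λ₁ x → InEigenspace A λ₂ y → x ∙ y ≈ 0#
  eigenspaces-orthogonal {A = A} A-sym {λ₁} {λ₂} λ₁≉λ₂ {x} {y} Ax Ay =
    *-cancelˡ-≈0 {λ₁ - λ₂} (λ eq → λ₁≉λ₂ (x-y≈0⇒x≈y eq)) (begin-equality
      (λ₁ - λ₂) * x ∙ y             ≈⟨ solve 3 (λ a b z → (a :- b) :* z := a :* z :- b :* z) refl λ₁ λ₂ (x ∙ y) ⟩
      λ₁ * x ∙ y - λ₂ * x ∙ y       ≈⟨ +-cong λ₁-side (-‿cong (∙-*ʳ x λ₂ y)) ⟨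
      (A · x) ∙ y - x ∙ (λ₂ *ᵛ y)   ≈⟨ +-cong (·-adjoint A-sym x y) (-‿cong (∙-congˡ x Ay)) ⟨
      x ∙ (A · y) - x ∙ (A · y)     ≈⟨ -‿inverseʳ _ ⟩
      0#                            ∎)
    where
    λ₁-side : (A · x) ∙ y ≈ λ₁ * x ∙ y
    λ₁-side = begin-equality
      (A · x) ∙ y    ≈⟨ ∙-comm (A · x) y ⟩
      y ∙ (A · x)    ≈⟨ ∙-congˡ y Ax ⟩
      y ∙ (λ₁ *ᵛ x)  ≈⟨ ∙-*ʳ y λ₁ x ⟩
      λ₁ * y ∙ x     ≈⟨ *-congˡ (∙-comm y x) ⟩
      λ₁ * x ∙ y     ∎

  -- Linear dependence, unit vectors and orthogonal complements.

  -- Gaussian elimination on the first coordinate. Without a pivot that coordinate is dropped; with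
  -- a pivot `p` it is cleared from the other vectors, and a relation among these lifts back.
  -- Scaling by the pivot entry avoids division.
  dependent : ∀ {m n} → n ℕ.< m → (v : Vector (Vector Carrier n) m) →
              ∃[ a ] linComb a v ≋ 0ᵛ × ∃[ k ] ¬ (a k ≈ 0#)
  dependent {suc m} {zero}  _ v = (λ _ → 1#) , (λ ()) , zero , λ 1≈0 → 0≉1 (sym 1≈0)
  dependent {suc m} {suc n} (s≤s n<m) v with nonzeroEntry (λ k → v k zero)
  ... | inj₂ column≈0 with dependent (ℕₚ.m<n⇒m<1+n n<m) (λ k → tail (v k))
  ...   | a , relation , a≉0 = a , relation′ , a≉0
    where
    relation′ : linComb a v ≋ 0ᵛ
    relation′ zero    = sum-zero λ k → trans (*-congˡ (column≈0 k)) (zeroʳ (a k))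
    relation′ (suc i) = relation i
  dependent {suc m} {suc n} (s≤s n<m) v | inj₁ (p , d≉0)
    with dependent n<m (λ j → tail (λ i → v p zero * v (punchIn p j) i - v (punchIn p j) zero * v p i))
  ... | a′ , relation , k , a′k≉0 = a , relation′ , punchIn p k , λ ak≈0 →
        a′k≉0 (*-cancelˡ-≈0 d≉0 (trans (reflexive (≡.sym (Vecₚ.insertAt-punchIn _ p s k))) ak≈0))
    where
    d = v p zero
    w : Vector (Vector Carrier (suc n)) m
    w j i = d * v (punchIn p j) i - v (punchIn p j) zero * v p i
    σ = sum (λ j → a′ j * v (punchIn p j) zero)
    s = - σ
    a = insertAt (λ j → d * a′ j) p s

    eliminate : ∀ i → linComb a v i ≈ linComb a′ w i
    eliminate i = begin-equality
      linComb a v i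
        ≈⟨ sum-remove {i = p} (λ k → a k * v k i) ⟩
      a p * v p i + sum (λ j → a (punchIn p j) * v (punchIn p j) i)
        ≈⟨ +-cong (*-congʳ (reflexive (Vecₚ.insertAt-lookup _ p s)))
                  (sum-cong-≋ λ j → *-congʳ {v (punchIn p j) i} (reflexive (Vecₚ.insertAt-punchIn _ p s j))) ⟩
      s * v p i + sum (λ j → (d * a′ j) * v (punchIn p j) i)
        ≈⟨ +-congʳ (trans (solve 2 (λ x y → :- x :* y := x :* :- y) refl σ (v p i))
                          (*-distribʳ-sum (- v p i) (λ j → a′ j * v (punchIn p j) zero))) ⟩
      sum (λ j → (a′ j * v (punchIn p j) zero) * - v p i) + sum (λ j → (d * a′ j) * v (punchIn p j) i)
        ≈⟨ ∑-distrib-+ (λ j → (a′ j * v (punchIn p j) zero) * - v p i) (λ j → (d * a′ j) * v (punchIn p j) i) ⟨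
      sum (λ j → (a′ j * v (punchIn p j) zero) * - v p i + (d * a′ j) * v (punchIn p j) i)
        ≈⟨ sum-cong-≋ (λ j → solve 5 (λ a c y d x → (a :* c) :* :- y :+ (d :* a) :* x := a :* (d :* x :- c :* y))
             refl (a′ j) (v (punchIn p j) zero) (v p i) d (v (punchIn p j) i)) ⟩
      linComb a′ w i ∎

    relation′ : linComb a v ≋ 0ᵛ
    relation′ zero    = trans (eliminate zero) (sum-zero λ j → trans
      (*-congˡ (trans (+-congʳ (*-comm d (v (punchIn p j) zero))) (-‿inverseʳ _))) (zeroʳ (a′ j)))
    relation′ (suc i) = trans (eliminate (suc i)) (relation i)

  unit : ∀ {n} → Fin n → Vector Carrier n
  unit j i = if does (i Finₚ.≟ j) then 1# else 0#

  unit-diagonal : ∀ {n} (j : Fin n) → unit j j ≈ 1#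
  unit-diagonal j rewrite dec-true (j Finₚ.≟ j) ≡.refl = refl

  unit-offDiagonal : ∀ {n} {i j : Fin n} → i ≢ j → unit j i ≈ 0#
  unit-offDiagonal {i = i} {j} i≢j rewrite dec-false (i Finₚ.≟ j) i≢j = refl

  unit-sym : ∀ {n} (i j : Fin n) → unit j i ≈ unit i j
  unit-sym i j with i Finₚ.≟ j
  ... | yes ≡.refl = sym (unit-diagonal i)
  ... | no  i≢j    = sym (unit-offDiagonal λ j≡i → i≢j (≡.sym j≡i))

  ∙-unit : ∀ {n} (x : Vector Carrier n) j → x ∙ unit j ≈ x j
  ∙-unit x j = begin-equality
    x ∙ unit j     ≈⟨ sum-single j (λ k k≢j → trans (*-congˡ (unit-offDiagonal k≢j)) (zeroʳ (x k))) ⟩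
    x j * unit j j ≈⟨ *-congˡ (unit-diagonal j) ⟩
    x j * 1#       ≈⟨ *-identityʳ (x j) ⟩
    x j            ∎

  infix 4 _⊥_
  _⊥_ : ∀ {m n} → Vector Carrier n → Vector (Vector Carrier n) m → Set ℓ
  x ⊥ v = ∀ k → x ∙ v k ≈ 0#

  -- A relation among the `n` columns of the transposed family is a vector orthogonal to every
  -- `v k`.
  ∃-nonzero-⊥ : ∀ {m n} → m ℕ.< n → (v : Vector (Vector Carrier n) m) → ∃[ x ] ¬ (x ≋ 0ᵛ) × x ⊥ v
  ∃-nonzero-⊥ m<n v with dependent m<n (flip v)
  ... | x , x⊥v , i , xi≉0 = x , (λ x≋0 → xi≉0 (x≋0 i)) , x⊥v

  ⊥-linear : ∀ {m n} (v : Vector (Vector Carrier n) m) a x b y → x ⊥ v → y ⊥ v → (a *ᵛ x +ᵛ b *ᵛ y) ⊥ v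
  ⊥-linear v a x b y x⊥v y⊥v k = begin-equality
    (a *ᵛ x +ᵛ b *ᵛ y) ∙ v k        ≈⟨ ∙-comm (a *ᵛ x +ᵛ b *ᵛ y) (v k) ⟩
    v k ∙ (a *ᵛ x +ᵛ b *ᵛ y)        ≈⟨ ∙-distribˡ (v k) (a *ᵛ x) (b *ᵛ y) ⟩
    v k ∙ (a *ᵛ x) + v k ∙ (b *ᵛ y) ≈⟨ +-cong (term a x x⊥v) (term b y y⊥v) ⟩
    0# + 0#                         ≈⟨ +-identityˡ 0# ⟩
    0#                              ∎
    where
    term : ∀ a x → x ⊥ v → v k ∙ (a *ᵛ x) ≈ 0#
    term a x x⊥v = begin-equality
      v k ∙ (a *ᵛ x) ≈⟨ ∙-*ʳ (v k) a x ⟩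
      a * v k ∙ x    ≈⟨ *-congˡ (trans (∙-comm (v k) x) (x⊥v k)) ⟩
      a * 0#         ≈⟨ zeroʳ a ⟩
      0#             ∎

  -- The quadratic form of a symmetric matrix, and shifts by a scalar.

  quadratic-expand : ∀ {n} {B : Matrix n} → Symmetric B → ∀ a b x y →
    let z = a *ᵛ x +ᵛ b *ᵛ y in
    z ∙ (B · z) ≈ a * a * x ∙ (B · x) + (1# + 1#) * (a * b) * x ∙ (B · y) + b * b * y ∙ (B · y)
  quadratic-expand {B = B} B-sym a b x y = begin-equality
    z ∙ (B · z)                              ≈⟨ ∙-comm z (B · z) ⟩
    (B · z) ∙ z                              ≈⟨ expand (B · z) ⟩
    a * (B · z) ∙ x + b * (B · z) ∙ y        ≈⟨ +-cong (*-congˡ (side x)) (*-congˡ (side y)) ⟩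
    a * (a * (B · x) ∙ x + b * (B · x) ∙ y) + b * (a * (B · y) ∙ x + b * (B · y) ∙ y)
      ≈⟨ +-cong (*-congˡ (+-cong (*-congˡ (∙-comm (B · x) x)) (*-congˡ (sym (·-adjoint B-sym x y)))))
                (*-congˡ (+-cong (*-congˡ (∙-comm (B · y) x)) (*-congˡ (∙-comm (B · y) y)))) ⟩
    a * (a * x ∙ (B · x) + b * x ∙ (B · y)) + b * (a * x ∙ (B · y) + b * y ∙ (B · y))
      ≈⟨ solve 5 (λ a b p q r → a :* (a :* p :+ b :* q) :+ b :* (a :* q :+ b :* r)
                    := a :* a :* p :+ (:1 :+ :1) :* (a :* b) :* q :+ b :* b :* r)
           refl a b (x ∙ (B · x)) (x ∙ (B · y)) (y ∙ (B · y)) ⟩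
    a * a * x ∙ (B · x) + (1# + 1#) * (a * b) * x ∙ (B · y) + b * b * y ∙ (B · y) ∎
    where
    z = a *ᵛ x +ᵛ b *ᵛ y
    expand : ∀ u → u ∙ z ≈ a * u ∙ x + b * u ∙ y
    expand u = trans (∙-distribˡ u (a *ᵛ x) (b *ᵛ y)) (+-cong (∙-*ʳ u a x) (∙-*ʳ u b y))
    side : ∀ u → (B · z) ∙ u ≈ a * (B · u) ∙ x + b * (B · u) ∙ y
    side u = begin-equality
      (B · z) ∙ u                        ≈⟨ ·-adjoint B-sym z u ⟨
      z ∙ (B · u)                        ≈⟨ ∙-comm z (B · u) ⟩
      (B · u) ∙ z                        ≈⟨ expand (B · u) ⟩
      a * (B · u) ∙ x + b * (B · u) ∙ y  ∎

  shift : ∀ {n} → Matrix n → Carrier → Matrix n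
  shift A s i j = A i j - s * unit i j

  shift-symmetric : ∀ {n} {A : Matrix n} → Symmetric A → ∀ s → Symmetric (shift A s)
  shift-symmetric A-sym s i j = +-cong (A-sym i j) (-‿cong (*-congˡ (unit-sym j i)))

  shift-· : ∀ {n} (A : Matrix n) s x i → (shift A s · x) i ≈ (A · x) i - s * x i
  shift-· A s x i = begin-equality
    (shift A s · x) i                  ≈⟨ ∙-comm (shift A s i) x ⟩
    x ∙ (A i +ᵛ (λ j → - (s * unit i j))) ≈⟨ ∙-cong {x = x} (λ _ → refl) (λ j → +-congˡ (-‿distribˡ-* s (unit i j))) ⟩
    x ∙ (A i +ᵛ - s *ᵛ unit i)         ≈⟨ ∙-distribˡ x (A i) (- s *ᵛ unit i) ⟩
    x ∙ A i + x ∙ (- s *ᵛ unit i)      ≈⟨ +-cong (∙-comm x (A i)) (trans (∙-*ʳ x (- s) (unit i)) (*-congˡ (∙-unit x i))) ⟩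
    (A · x) i + - s * x i              ≈⟨ +-congˡ (-‿distribˡ-* s (x i)) ⟨
    (A · x) i - s * x i                ∎

  ∙-shift : ∀ {n} (A : Matrix n) s x y → x ∙ (shift A s · y) ≈ x ∙ (A · y) - s * x ∙ y
  ∙-shift A s x y = begin-equality
    x ∙ (shift A s · y)           ≈⟨ ∙-congˡ x (λ i → trans (shift-· A s y i) (+-congˡ (-‿distribˡ-* s (y i)))) ⟩
    x ∙ (A · y +ᵛ - s *ᵛ y)       ≈⟨ ∙-distribˡ x (A · y) (- s *ᵛ y) ⟩
    x ∙ (A · y) + x ∙ (- s *ᵛ y)  ≈⟨ +-congˡ (trans (∙-*ʳ x (- s) y) (sym (-‿distribˡ-* s _))) ⟩
    x ∙ (A · y) - s * x ∙ y       ∎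

  kernel-shift : ∀ {n} {A : Matrix n} {s x} → shift A s · x ≋ 0ᵛ → InEigenspace A s x
  kernel-shift {A = A} {s} {x} Bx≋0 i = x-y≈0⇒x≈y (trans (sym (shift-· A s x i)) (Bx≋0 i))

  -- Bordered linear systems: degeneracy or coercivity on an orthogonal complement.

  module _ {n p : ℕ} {B : Matrix n} (B-sym : Symmetric B)
           {v : Vector (Vector Carrier n) p} (v-independent : LinearlyIndependent v)
           (B-invariant : ∀ x → x ⊥ v → (B · x) ⊥ v)
           where

    private
      -- The equation `B y = unit j` in weak form: it is tested only against vectors of the
      -- complement of `v`, where `y` lies too.
      Solution : Fin n → Set (c ⊔ ℓ)
      Solution j = ∃[ y ] y ⊥ v × (∀ x → x ⊥ v → x ∙ (B · y) ≈ x j)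

    -- The columns of the symmetric block matrix with blocks `B`, `v`, its transpose and zero,
    -- together with `unit j` padded by zeros, are `n + p + 1` vectors in `n + p` dimensions. A
    -- relation among them reads `d e_j + B y + V b = 0` with `y ⊥ v`, where `e_j` is `unit j` and
    -- `V b` is `linComb b v`. Whether `d` vanishes decides the alternative.
    kernel⊎solution : (j : Fin n) → (∃[ y ] ¬ (y ≋ 0ᵛ) × y ⊥ v × B · y ≋ 0ᵛ) ⊎ Solution j
    kernel⊎solution j = go
      where
      column : Fin n ⊎ Fin p → Fin n ⊎ Fin p → Carrier
      column (inj₁ i) (inj₁ r) = B r i
      column (inj₁ i) (inj₂ k) = v k i
      column (inj₂ k) (inj₁ r) = v k r
      column (inj₂ k) (inj₂ l) = 0#

      system : Vector (Vector Carrier (n ℕ.+ p)) (suc (n ℕ.+ p))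
      system zero    r = [ unit j , (λ _ → 0#) ]′ (splitAt n r)
      system (suc l) r = column (splitAt n l) (splitAt n r)

      relation : ∃[ a ] linComb a system ≋ 0ᵛ × ∃[ k ] ¬ (a k ≈ 0#)
      relation = dependent ℕₚ.≤-refl system

      a = proj₁ relation
      d = a zero
      y : Vector Carrier n
      y i = a (suc (i ↑ˡ p))
      b : Vector Carrier p
      b k = a (suc (n ↑ʳ k))

      block : ∀ r → (d * [ unit j , (λ _ → 0#) ]′ (splitAt n r) +
                      (y ∙ (λ i → column (inj₁ i) (splitAt n r)) + b ∙ (λ k → column (inj₂ k) (splitAt n r))))
                    ≈ 0#
      block r = trans (+-congˡ (trans
        (+-cong (sum-cong-≋ λ i → reflexive (≡.cong (λ l → y i * column l (splitAt n r)) (≡.sym (splitAt-↑ˡ n i p))))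
                (sum-cong-≋ λ k → reflexive (≡.cong (λ l → b k * column l (splitAt n r)) (≡.sym (splitAt-↑ʳ n p k)))))
        (sym (sum-++ n (λ l → a (suc l) * system (suc l) r))))) (proj₁ (proj₂ relation) r)

      equation₁ : ∀ r → d * unit j r + ((B · y) r + linComb b v r) ≈ 0#
      equation₁ r with splitAt n (r ↑ˡ p) | splitAt-↑ˡ n r p | block (r ↑ˡ p)
      ... | _ | ≡.refl | eq = trans (+-congˡ (+-congʳ (∙-comm (B r) y))) eq

      y⊥v : y ⊥ v
      y⊥v k with splitAt n (n ↑ʳ k) | splitAt-↑ʳ n p k | block (n ↑ʳ k)
      ... | _ | ≡.refl | eq = begin-equality
        y ∙ v k                       ≈⟨ solve 1 (λ x → x := :0 :+ (x :+ :0)) refl (y ∙ v k) ⟩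
        0# + (y ∙ v k + 0#)           ≈⟨ +-cong (zeroʳ d) (+-congˡ (∙-zeroʳ b)) ⟨
        d * 0# + (y ∙ v k + b ∙ 0ᵛ)   ≈⟨ eq ⟩
        0#                            ∎

      go : (∃[ y ] ¬ (y ≋ 0ᵛ) × y ⊥ v × B · y ≋ 0ᵛ) ⊎ Solution j
      go with d ≟ 0#
      -- For `x ⊥ v` the term `x ∙ V b` vanishes, so `x ∙ (B · y)` is `- (d * x j)`; rescaling `y`
      -- by `- d⁻¹` solves the equation.
      ... | no d≉0 = inj₂ (- d⁻¹ *ᵛ y , y′⊥v , λ x x⊥v → begin-equality
          x ∙ (B · (- d⁻¹ *ᵛ y))      ≈⟨ ·-adjoint B-sym x (- d⁻¹ *ᵛ y) ⟩
          (B · x) ∙ (- d⁻¹ *ᵛ y)      ≈⟨ ∙-*ʳ (B · x) (- d⁻¹) y ⟩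
          - d⁻¹ * (B · x) ∙ y         ≈⟨ *-congˡ (·-adjoint B-sym x y) ⟨
          - d⁻¹ * x ∙ (B · y)         ≈⟨ *-congˡ (projection x x⊥v) ⟩
          - d⁻¹ * - (d * x j)         ≈⟨ solve 3 (λ d d⁻¹ z → :- d⁻¹ :* :- (d :* z) := (d :* d⁻¹) :* z) refl d d⁻¹ (x j) ⟩
          (d * d⁻¹) * x j             ≈⟨ *-congʳ (proj₂ (invertible d d≉0)) ⟩
          1# * x j                    ≈⟨ *-identityˡ (x j) ⟩
          x j                         ∎)
        where
        d⁻¹ = proj₁ (invertible d d≉0)
        y′⊥v : (- d⁻¹ *ᵛ y) ⊥ v
        y′⊥v k = begin-equality
          (- d⁻¹ *ᵛ y) ∙ v k  ≈⟨ ∙-comm (- d⁻¹ *ᵛ y) (v k) ⟩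
          v k ∙ (- d⁻¹ *ᵛ y)  ≈⟨ ∙-*ʳ (v k) (- d⁻¹) y ⟩
          - d⁻¹ * v k ∙ y     ≈⟨ *-congˡ (trans (∙-comm (v k) y) (y⊥v k)) ⟩
          - d⁻¹ * 0#          ≈⟨ zeroʳ (- d⁻¹) ⟩
          0#                  ∎
        projection : ∀ x → x ⊥ v → x ∙ (B · y) ≈ - (d * x j)
        projection x x⊥v = begin-equality
          x ∙ (B · y)
            ≈⟨ solve 3 (λ e f g → f := (e :+ (f :+ g)) :- g :- e) refl (d * x j) (x ∙ (B · y)) (x ∙ linComb b v) ⟩
          (d * x j + (x ∙ (B · y) + x ∙ linComb b v)) - x ∙ linComb b v - d * x j
            ≈⟨ +-congʳ (+-cong total (-‿cong (∙-linComb-≈0 x b v x⊥v))) ⟩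
          0# - 0# - d * x j  ≈⟨ solve 1 (λ e → :0 :- :0 :- e := :- e) refl (d * x j) ⟩
          - (d * x j)        ∎
          where
          total : d * x j + (x ∙ (B · y) + x ∙ linComb b v) ≈ 0#
          total = begin-equality
            d * x j + (x ∙ (B · y) + x ∙ linComb b v)
              ≈⟨ +-cong (trans (∙-*ʳ x d (unit j)) (*-congˡ (∙-unit x j))) (∙-distribˡ x (B · y) (linComb b v)) ⟨
            x ∙ (d *ᵛ unit j) + x ∙ (B · y +ᵛ linComb b v)
              ≈⟨ ∙-distribˡ x (d *ᵛ unit j) (B · y +ᵛ linComb b v) ⟨
            x ∙ (d *ᵛ unit j +ᵛ (B · y +ᵛ linComb b v)) ≈⟨ ∙-congˡ x equation₁ ⟩
            x ∙ 0ᵛ                                      ≈⟨ ∙-zeroʳ x ⟩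
            0#                                          ∎
      -- Now `B y + V b = 0`. By invariance `B y` is orthogonal to `V b`, so both vanish and `y`
      -- lies in the kernel.
      ... | yes d≈0 with nonzeroEntry y
      ...   | inj₁ (i , yi≉0) = inj₁ (y , (λ y≋0 → yi≉0 (y≋0 i)) , y⊥v , λ r → begin-equality
          (B · y) r                    ≈⟨ +-identityʳ _ ⟨
          (B · y) r + 0#               ≈⟨ +-congˡ (Vb≋0 r) ⟨
          (B · y) r + linComb b v r    ≈⟨ By+Vb≋0 r ⟩
          0#                           ∎)
        where
        By+Vb≋0 : ∀ r → (B · y) r + linComb b v r ≈ 0#
        By+Vb≋0 r = begin-equality
          (B · y) r + linComb b v r                       ≈⟨ +-identityˡ _ ⟨
          0# + ((B · y) r + linComb b v r)                ≈⟨ +-congʳ (trans (*-congʳ d≈0) (zeroˡ _)) ⟨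
          d * unit j r + ((B · y) r + linComb b v r)      ≈⟨ equation₁ r ⟩
          0#                                              ∎
        Vb = linComb b v
        Vb≋0 : Vb ≋ 0ᵛ
        Vb≋0 = x∙x≈0⇒x≋0 (begin-equality
          Vb ∙ Vb                  ≈⟨ +-identityˡ _ ⟨
          0# + Vb ∙ Vb             ≈⟨ +-congʳ (trans (∙-comm Vb (B · y)) (∙-linComb-≈0 (B · y) b v (B-invariant y y⊥v))) ⟨
          Vb ∙ (B · y) + Vb ∙ Vb   ≈⟨ ∙-distribˡ Vb (B · y) Vb ⟨
          Vb ∙ (B · y +ᵛ Vb)       ≈⟨ ∙-congˡ Vb By+Vb≋0 ⟩
          Vb ∙ 0ᵛ                  ≈⟨ ∙-zeroʳ Vb ⟩
          0#                       ∎)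
      -- If `y` vanishes as well, independence of `v` forces `b` to vanish, and the relation was
      -- trivial.
      ...   | inj₂ y≋0 = contradiction (a≋0 _) (proj₂ (proj₂ (proj₂ relation)))
        where
        b≋0 : b ≋ 0ᵛ
        b≋0 = v-independent b λ r → begin-equality
          linComb b v r                               ≈⟨ solve 1 (λ x → x := :0 :+ (:0 :+ x)) refl _ ⟩
          0# + (0# + linComb b v r)                   ≈⟨ +-cong (trans (*-congʳ d≈0) (zeroˡ _))
            (+-congʳ (trans (∙-congˡ (B r) y≋0) (∙-zeroʳ (B r)))) ⟨
          d * unit j r + ((B · y) r + linComb b v r)  ≈⟨ equation₁ r ⟩
          0#                                          ∎
        a≋0 : a ≋ 0ᵛ
        a≋0 zero = d≈0
        a≋0 (suc l) with splitAt n l | Finₚ.join-splitAt n p l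
        ... | inj₁ i | ≡.refl = y≋0 i
        ... | inj₂ k | ≡.refl = b≋0 k

    -- 0 ≤ q(κ x − xⱼ yⱼ) for the form q(x) = x ∙ B x gives xⱼ² ≤ κ q(x) as soon as κ ≥ q(yⱼ).
    coercive : (∀ x → x ⊥ v → 0# ≤ x ∙ (B · x)) → (∀ j → Solution j) →
               ∃[ M ] 0# < M × (∀ x → x ⊥ v → x ∙ x ≤ M * x ∙ (B · x))
    coercive q-nonneg solution = M , 0<M , λ x x⊥v → 0≤y-x⇒x≤y (≤-respʳ (begin-equality
        sum (λ j → κ * q x - x j * x j) + q x
          ≈⟨ +-congʳ (∑-distrib-+ (λ _ → κ * q x) (λ j → - (x j * x j))) ⟩
        (sum {n} (λ _ → κ * q x) + sum (λ j → - (x j * x j))) + q x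
          ≈⟨ +-congʳ (+-cong
               (trans (sum-cong-≋ {n} λ _ → solve 2 (λ κ q → κ :* q := q :* κ) refl κ (q x))
                      (sym (*-distribˡ-sum {n} (q x) (λ _ → κ))))
               (trans (sum-cong-≋ λ j → solve 1 (λ z → :- z := (:- :1) :* z) refl (x j * x j))
                      (sym (*-distribˡ-sum (- 1#) (λ j → x j * x j))))) ⟩
        (q x * sum {n} (λ _ → κ) + - 1# * x ∙ x) + q x
          ≈⟨ solve 3 (λ q N z → (q :* N :+ (:- :1) :* z) :+ q := (:1 :+ N) :* q :- z) refl
               (q x) (sum {n} (λ _ → κ)) (x ∙ x) ⟩
        M * q x - x ∙ x ∎)
      (+-nonneg (sum-nonneg (bound x x⊥v)) (q-nonneg x x⊥v)))
      where
      q : Vector Carrier n → Carrier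
      q x = x ∙ (B · x)
      y : Fin n → Vector Carrier n
      y j = proj₁ (solution j)
      y⊥v : ∀ j → y j ⊥ v
      y⊥v j = proj₁ (proj₂ (solution j))
      0≤qy : ∀ j → 0# ≤ q (y j)
      0≤qy j = q-nonneg (y j) (y⊥v j)
      -- One `κ` dominates `q (y j)` for all `j` at once; the summand 1 makes it positive, so that
      -- it can be cancelled in `bound`.
      κ = 1# + sum (λ j → q (y j))
      0<κ : 0# < κ
      0<κ = <-+-≤ 0<1 (sum-nonneg 0≤qy)
      -- Adding the `n` coordinate bounds yields the sum of the `κ`; the extra 1 keeps `M` positive
      -- without a case distinction on `n`.
      M = 1# + sum {n} (λ _ → κ)
      0<M : 0# < M
      0<M = <-+-≤ 0<1 (sum-nonneg {n} λ _ → inj₁ 0<κ)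

      bound : ∀ x → x ⊥ v → ∀ j → 0# ≤ κ * q x - x j * x j
      bound x x⊥v j = *-cancelˡ-nonneg 0<κ (≤-respʳ (begin-equality
          q z + (κ - q (y j)) * (x j * x j)
            ≈⟨ +-congʳ (trans (quadratic-expand B-sym κ (- x j) x (y j))
                 (+-congʳ (+-congˡ (*-congˡ (proj₂ (proj₂ (solution j)) x x⊥v))))) ⟩
          (κ * κ * q x + (1# + 1#) * (κ * - x j) * x j + - x j * - x j * q (y j)) + (κ - q (y j)) * (x j * x j)
            ≈⟨ solve 4 (λ κ q x r →
                 (κ :* κ :* q :+ (:1 :+ :1) :* (κ :* :- x) :* x :+ :- x :* :- x :* r) :+ (κ :- r) :* (x :* x)
                          := κ :* (κ :* q :- x :* x)) refl κ (q x) (x j) (q (y j)) ⟩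
          κ * (κ * q x - x j * x j) ∎)
        (+-nonneg (q-nonneg z (⊥-linear v κ x (- x j) (y j) x⊥v (y⊥v j)))
                  (*-nonneg κ-qy (square-nonneg (x j)))))
        where
        z = κ *ᵛ x +ᵛ - x j *ᵛ y j
        κ-qy : 0# ≤ κ - q (y j)
        κ-qy = ≤-respʳ (solve 2 (λ s r → :1 :+ (s :- r) := (:1 :+ s) :- r) refl _ (q (y j)))
                 (+-nonneg (inj₁ 0<1) (term≤sum 0≤qy j))

  -- An eigenvector inside an invariant orthogonal complement.

  -- Gathers the alternatives of `kernel⊎solution`: a kernel vector from any one coordinate
  -- suffices, whereas coercivity needs solutions for all of them.
  ∀⊎ : ∀ {a b} {P : Set a} {n} {Q : Fin n → Set b} → (∀ i → P ⊎ Q i) → P ⊎ (∀ i → Q i)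
  ∀⊎ {n = zero}  f = inj₂ λ ()
  ∀⊎ {n = suc n} f with f zero | ∀⊎ (f ∘ suc)
  ... | inj₁ p | _      = inj₁ p
  ... | inj₂ _ | inj₁ p = inj₁ p
  ... | inj₂ q | inj₂ r = inj₂ λ { zero → q ; (suc i) → r i }

  ∙-positive : ∀ {n} {x : Vector Carrier n} → ¬ (x ≋ 0ᵛ) → 0# < x ∙ x
  ∙-positive {x = x} x≉0 with ∙-nonneg x
  ... | inj₁ 0<xx = 0<xx
  ... | inj₂ 0≈xx = contradiction (x∙x≈0⇒x≋0 (sym 0≈xx)) x≉0

  ≤-quotient : ∀ {d d⁻¹ e r} → 0# < d → d * d⁻¹ ≈ 1# → r * d ≤ e → r ≤ d⁻¹ * e
  ≤-quotient {d} {d⁻¹} {e} {r} 0<d inverse rd≤e = 0≤y-x⇒x≤y (≤-respʳ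
    (begin-equality
      d⁻¹ * (e - r * d)       ≈⟨ solve 4 (λ d i e r → i :* (e :- r :* d) := i :* e :- r :* (d :* i)) refl d d⁻¹ e r ⟩
      d⁻¹ * e - r * (d * d⁻¹) ≈⟨ +-congˡ (-‿cong (trans (*-congˡ inverse) (*-identityʳ r))) ⟩
      d⁻¹ * e - r             ∎)
    (*-nonneg (inj₁ (0<x⇒0<x⁻¹ 0<d inverse)) (x≤y⇒0≤y-x rd≤e)))

  quotient-< : ∀ {d d⁻¹ e r} → 0# < d → d * d⁻¹ ≈ 1# → e < r * d → d⁻¹ * e < r
  quotient-< {d} {d⁻¹} {e} {r} 0<d inverse e<rd = 0<y-x⇒x<y (<-respʳ
    (begin-equality
      d⁻¹ * (r * d - e)       ≈⟨ solve 4 (λ d i e r → i :* (r :* d :- e) := r :* (d :* i) :- i :* e) refl d d⁻¹ e r ⟩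
      r * (d * d⁻¹) - d⁻¹ * e ≈⟨ +-congʳ (trans (*-congˡ inverse) (*-identityʳ r)) ⟩
      r - d⁻¹ * e             ∎)
    (*-pos (0<x⇒0<x⁻¹ 0<d inverse) (x<y⇒0<y-x e<rd)))

  positive-inverse : ∀ {d} → 0# < d → ∃[ d⁻¹ ] d * d⁻¹ ≈ 1#
  positive-inverse 0<d = invertible _ λ d≈0 → irrefl (sym d≈0) 0<d

  -- Dividing the coercivity estimate by `M` leaves a surplus `ε * z`, by which the Rayleigh bound
  -- `s` can grow.
  raise-bound : ∀ {M ε z f s} → 0# < M → M * ε ≈ 1# → z ≤ M * (f - s * z) → (s + ε) * z ≤ f
  raise-bound {M} {ε} {z} {f} {s} 0<M Mε≈1 z≤Mq = 0≤y-x⇒x≤y (≤-respʳ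
    (begin-equality
      ε * (M * (f - s * z) - z)
        ≈⟨ solve 4 (λ e M q z → e :* (M :* q :- z) := (M :* e) :* q :- e :* z) refl ε M (f - s * z) z ⟩
      (M * ε) * (f - s * z) - ε * z
        ≈⟨ +-congʳ (trans (*-congʳ Mε≈1) (*-identityˡ _)) ⟩
      (f - s * z) - ε * z
        ≈⟨ solve 4 (λ f s e z → (f :- s :* z) :- e :* z := f :- (s :+ e) :* z) refl f s ε z ⟩
      f - (s + ε) * z ∎)
    (*-nonneg (inj₁ (0<x⇒0<x⁻¹ 0<M Mε≈1)) (x≤y⇒0≤y-x z≤Mq)))

  -- s is the infimum of the Rayleigh quotient on the invariant subspace v^⊥. If
  -- A − s were nonsingular there, it would be coercive, and s could be increased.
  eigenvector-⊥ : ∀ {n p} {A : Matrix n} → Symmetric A →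
                  ∀ {t} → (∀ x → t * x ∙ x ≤ x ∙ (A · x)) →
                  p ℕ.< n → {v : Vector (Vector Carrier n) p} → LinearlyIndependent v →
                  (∀ x → x ⊥ v → (A · x) ⊥ v) →
                  ∃[ s ] ∃[ x ] ¬ (x ≋ 0ᵛ) × x ⊥ v × InEigenspace A s x
  eigenvector-⊥ {n} {p} {A} A-sym {t} t-bound p<n {v} v-independent A-invariant =
    s , [ (λ (x , x≉0 , x⊥v , Bx≋0) → x , x≉0 , x⊥v , kernel-shift Bx≋0)
        , (λ solution → contradiction solution unsolvable) ]′
          (∀⊎ (kernel⊎solution B-sym {v} v-independent B-invariant))
    where
    -- Bounds on the Rayleigh quotient, multiplied out so that the zero vector is no exception.
    LowerBound : Carrier → Set (c ⊔ ℓ)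
    LowerBound r = ∀ x → x ⊥ v → r * x ∙ x ≤ x ∙ (A · x)

    upperBound : ∃ (IsUpperBound LowerBound)
    upperBound with ∃-nonzero-⊥ p<n v
    ... | x , x≉0 , x⊥v = proj₁ inverse * x ∙ (A · x) , λ r r-bound →
          ≤-quotient (∙-positive x≉0) (proj₂ inverse) (r-bound x x⊥v)
      where inverse = positive-inverse (∙-positive x≉0)

    supremum-bound : ∃[ s ] IsUpperBound LowerBound s × (∀ u → IsUpperBound LowerBound u → s ≤ u)
    supremum-bound = supremum LowerBound (t , λ x _ → t-bound x) upperBound

    s : Carrier
    s = proj₁ supremum-bound

    -- A vector violating this would have a Rayleigh quotient below `s`, and that quotient would be
    -- a smaller upper bound of all lower bounds.
    s-bound : LowerBound s
    s-bound x x⊥v = ≮⇒≥ impossible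
      where
      impossible : ¬ (x ∙ (A · x) < s * x ∙ x)
      impossible xAx<sxx = <⇒≱ (quotient-< 0<xx (proj₂ inverse) xAx<sxx)
        (proj₂ (proj₂ supremum-bound) _ λ r r-bound → ≤-quotient 0<xx (proj₂ inverse) (r-bound x x⊥v))
        where
        x≉0 : ¬ (x ≋ 0ᵛ)
        x≉0 x≋0 = irrefl (begin-equality
          x ∙ (A · x)   ≈⟨ ∙-comm x (A · x) ⟩
          (A · x) ∙ x   ≈⟨ ∙-congˡ (A · x) x≋0 ⟩
          (A · x) ∙ 0ᵛ  ≈⟨ ∙-zeroʳ (A · x) ⟩
          0#            ≈⟨ zeroʳ s ⟨
          s * 0#        ≈⟨ *-congˡ (∙-zeroʳ x) ⟨
          s * x ∙ 0ᵛ    ≈⟨ *-congˡ (∙-congˡ x x≋0) ⟨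
          s * x ∙ x     ∎) xAx<sxx
        0<xx = ∙-positive x≉0
        inverse = positive-inverse 0<xx

    B : Matrix n
    B = shift A s

    B-sym : Symmetric B
    B-sym = shift-symmetric A-sym s

    B-invariant : ∀ x → x ⊥ v → (B · x) ⊥ v
    B-invariant x x⊥v k = begin-equality
      (B · x) ∙ v k                  ≈⟨ ∙-comm (B · x) (v k) ⟩
      v k ∙ (B · x)                  ≈⟨ ∙-shift A s (v k) x ⟩
      v k ∙ (A · x) - s * v k ∙ x    ≈⟨ +-cong (trans (∙-comm (v k) (A · x)) (A-invariant x x⊥v k))
                                               (-‿cong (*-congˡ (trans (∙-comm (v k) x) (x⊥v k)))) ⟩
      0# - s * 0#                    ≈⟨ solve 1 (λ s → :0 :- s :* :0 := :0) refl s ⟩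
      0#                             ∎

    q-nonneg : ∀ x → x ⊥ v → 0# ≤ x ∙ (B · x)
    q-nonneg x x⊥v = ≤-respʳ (sym (∙-shift A s x x)) (x≤y⇒0≤y-x (s-bound x x⊥v))

    unsolvable : ¬ (∀ j → ∃[ y ] y ⊥ v × (∀ x → x ⊥ v → x ∙ (B · y) ≈ x j))
    unsolvable solution = <⇒≱ s<s+ε (proj₁ (proj₂ supremum-bound) (s + ε) λ x x⊥v →
        raise-bound 0<M Mε≈1 (≤-respʳ (*-congˡ (∙-shift A s x x)) (M-bound x x⊥v)))
      where
      coercivity : ∃[ M ] 0# < M × (∀ x → x ⊥ v → x ∙ x ≤ M * x ∙ (B · x))
      coercivity = coercive B-sym {v} v-independent B-invariant q-nonneg solution
      M = proj₁ coercivity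
      0<M = proj₁ (proj₂ coercivity)
      M-bound = proj₂ (proj₂ coercivity)
      ε = proj₁ (positive-inverse 0<M)
      Mε≈1 = proj₂ (positive-inverse 0<M)
      s<s+ε : s < s + ε
      s<s+ε = 0<y-x⇒x<y (<-respʳ (solve 2 (λ s e → e := (s :+ e) :- s) refl s ε) (0<x⇒0<x⁻¹ 0<M Mε≈1))

  -- Independence and spanning.

  linComb-++ : ∀ {m p n} a (v : Vector (Vector Carrier n) m) (w : Vector (Vector Carrier n) p) →
               linComb a (v ++ w) ≋ linComb (λ k → a (k ↑ˡ p)) v +ᵛ linComb (λ k → a (m ↑ʳ k)) w
  linComb-++ {m} {p} a v w i = trans (sum-++ m (λ k → a k * (v ++ w) k i)) (+-cong
    (sum-cong-≋ λ k → *-congˡ (reflexive (≡.cong (λ l → [ v , w ]′ l i) (splitAt-↑ˡ m k p))))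
    (sum-cong-≋ λ k → *-congˡ (reflexive (≡.cong (λ l → [ v , w ]′ l i) (splitAt-↑ʳ m p k)))))

  -- In a relation `x + y = 0` whose two parts are orthogonal, `x ∙ x` vanishes, so each part is a
  -- relation of its own.
  independent-++ : ∀ {m p n} (v : Vector (Vector Carrier n) m) (w : Vector (Vector Carrier n) p) →
                   LinearlyIndependent v → LinearlyIndependent w → (∀ k → v k ⊥ w) → LinearlyIndependent (v ++ w)
  independent-++ {m} {p} v w v-independent w-independent v⊥w a relation = a≋0
    where
    a₁ = λ k → a (k ↑ˡ p)
    a₂ = λ k → a (m ↑ʳ k)
    x = linComb a₁ v
    y = linComb a₂ w
    x+y≋0 : x +ᵛ y ≋ 0ᵛ
    x+y≋0 i = trans (sym (linComb-++ a v w i)) (relation i)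
    x∙y≈0 : x ∙ y ≈ 0#
    x∙y≈0 = ∙-linComb-≈0 x a₂ w λ l → trans (∙-comm x (w l))
              (∙-linComb-≈0 (w l) a₁ v λ k → trans (∙-comm (w l) (v k)) (v⊥w k l))
    x≋0 : x ≋ 0ᵛ
    x≋0 = x∙x≈0⇒x≋0 (begin-equality
      x ∙ x           ≈⟨ +-identityʳ _ ⟨
      x ∙ x + 0#      ≈⟨ +-congˡ x∙y≈0 ⟨
      x ∙ x + x ∙ y   ≈⟨ ∙-distribˡ x x y ⟨
      x ∙ (x +ᵛ y)    ≈⟨ ∙-congˡ x x+y≋0 ⟩
      x ∙ 0ᵛ          ≈⟨ ∙-zeroʳ x ⟩
      0#              ∎)
    y≋0 : y ≋ 0ᵛ
    y≋0 i = begin-equality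
      y i        ≈⟨ +-identityˡ _ ⟨
      0# + y i   ≈⟨ +-congʳ (x≋0 i) ⟨
      x i + y i  ≈⟨ x+y≋0 i ⟩
      0#         ∎
    a≋0 : a ≋ 0ᵛ
    a≋0 l with splitAt m l | Finₚ.join-splitAt m p l
    ... | inj₁ k | ≡.refl = v-independent a₁ x≋0 k
    ... | inj₂ k | ≡.refl = w-independent a₂ y≋0 k

  independent⇒≤ : ∀ {m n} (v : Vector (Vector Carrier n) m) → LinearlyIndependent v → m ℕ.≤ n
  independent⇒≤ v v-independent = ℕₚ.≮⇒≥ λ n<m →
    let a , relation , k , ak≉0 = dependent n<m v in ak≉0 (v-independent a relation k)

  -- Together with `x` the vectors are one too many. In a relation among them the coefficient of `x`
  -- cannot vanish, so the relation can be solved for `x`.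
  independent⇒spanning : ∀ {n} (v : Vector (Vector Carrier n) n) → LinearlyIndependent v →
                         ∀ x → ∃[ a ] x ≋ linComb a v
  independent⇒spanning {n} v v-independent x = a , x≋av
    where
    relation : ∃[ a ] linComb a (x ∷ᵛ v) ≋ 0ᵛ × ∃[ k ] ¬ (a k ≈ 0#)
    relation = dependent ℕₚ.≤-refl (x ∷ᵛ v)
    b = proj₁ relation
    b≉0 : ¬ (b zero ≈ 0#)
    b≉0 b₀≈0 = proj₂ (proj₂ (proj₂ relation)) (b≋0 _)
      where
      b≋0 : b ≋ 0ᵛ
      b≋0 zero    = b₀≈0
      b≋0 (suc k) = v-independent (b ∘ suc) (λ i → begin-equality
        linComb (b ∘ suc) v i                ≈⟨ +-identityˡ _ ⟨
        0# + linComb (b ∘ suc) v i           ≈⟨ +-congʳ (trans (*-congʳ b₀≈0) (zeroˡ (x i))) ⟨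
        b zero * x i + linComb (b ∘ suc) v i ≈⟨ proj₁ (proj₂ relation) i ⟩
        0#                                   ∎) k
    b⁻¹ = proj₁ (invertible (b zero) b≉0)
    a : Vector Carrier n
    a k = - b⁻¹ * b (suc k)
    x≋av : x ≋ linComb a v
    x≋av i = begin-equality
      x i                                  ≈⟨ *-identityˡ (x i) ⟨
      1# * x i                             ≈⟨ *-congʳ (proj₂ (invertible (b zero) b≉0)) ⟨
      (b zero * b⁻¹) * x i
        ≈⟨ solve 4 (λ b i x r → (b :* i) :* x := i :* (b :* x :+ r) :+ :- i :* r)
             refl (b zero) b⁻¹ (x i) (linComb (b ∘ suc) v i) ⟩
      b⁻¹ * (b zero * x i + linComb (b ∘ suc) v i) + - b⁻¹ * linComb (b ∘ suc) v i
        ≈⟨ +-cong (trans (*-congˡ (proj₁ (proj₂ relation) i)) (zeroʳ b⁻¹))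
                 (*-distribˡ-sum (- b⁻¹) (λ k → b (suc k) * v k i)) ⟩
      0# + sum (λ k → - b⁻¹ * (b (suc k) * v k i))
        ≈⟨ trans (+-identityˡ _) (sum-cong-≋ λ k → sym (*-assoc (- b⁻¹) (b (suc k)) (v k i))) ⟩
      linComb a v i ∎

  -- Families of vectors in blocks of prescribed sizes.

  -- Block `i` has the type of a basis in `HasMultiplicity` for the entry `lookup ms i`, so
  -- eigenspace bases fit without conversion.
  Family : ∀ {a} → Set a → List ℕ → Set a
  Family X ms = ∀ i → Vector X (lookup ms i)

  module _ {a} {X : Set a} where

    flat : ∀ ms → Family X ms → Vector X (ListAction.sum ms)
    flat []       U = λ ()
    flat (m ∷ ms) U = U zero ++ flat ms (λ i → U (suc i))

    flat-all⁺ : ∀ {p} (P : X → Set p) ms (U : Family X ms) → (∀ i k → P (U i k)) → ∀ l → P (flat ms U l)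
    flat-all⁺ P (m ∷ ms) U PU l with splitAt m l
    ... | inj₁ k = PU zero k
    ... | inj₂ k = flat-all⁺ P ms (λ i → U (suc i)) (λ i → PU (suc i)) k

    flat-all⁻ : ∀ {p} (P : X → Set p) ms (U : Family X ms) → (∀ l → P (flat ms U l)) → ∀ i k → P (U i k)
    flat-all⁻ P (m ∷ ms) U PU zero k =
      ≡.subst (λ l → P ([ U zero , flat ms (λ i → U (suc i)) ]′ l)) (splitAt-↑ˡ m k _) (PU (k ↑ˡ ListAction.sum ms))
    flat-all⁻ P (m ∷ ms) U PU (suc i) k = flat-all⁻ P ms (λ i → U (suc i))
      (λ l → ≡.subst (λ l → P ([ U zero , flat ms (λ i → U (suc i)) ]′ l)) (splitAt-↑ʳ m _ l) (PU (m ↑ʳ l))) i k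

  OrthogonalBlocks : ∀ {n} ms → Family (Vector Carrier n) ms → Set ℓ
  OrthogonalBlocks ms U = ∀ i j → i ≢ j → ∀ k → U i k ⊥ U j

  flat-independent : ∀ {n} ms (U : Family (Vector Carrier n) ms) → (∀ i → LinearlyIndependent (U i)) →
                     OrthogonalBlocks ms U → LinearlyIndependent (flat ms U)
  flat-independent []       U U-independent U-orthogonal = λ _ _ ()
  flat-independent (m ∷ ms) U U-independent U-orthogonal = independent-++ (U zero) (flat ms (λ i → U (suc i)))
    (U-independent zero)
    (flat-independent ms (λ i → U (suc i)) (λ i → U-independent (suc i))
      λ i j i≢j → U-orthogonal (suc i) (suc j) λ si≡sj → i≢j (Finₚ.suc-injective si≡sj))
    (λ k → flat-all⁺ (λ w → U zero k ∙ w ≈ 0#) ms (λ i → U (suc i)) λ j → U-orthogonal zero (suc j) (λ ()) k)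

  -- The remainder `r` collects the other blocks. Only what orthogonality to those blocks implies
  -- for it is recorded, which spares an indexing of the family with one block removed.
  flat-decompose : ∀ {n} ms (U : Family (Vector Carrier n) ms) i a →
    ∃[ b ] ∃[ r ] linComb a (flat ms U) ≋ linComb b (U i) +ᵛ r × (∀ x → (∀ j → j ≢ i → x ⊥ U j) → x ∙ r ≈ 0#)
  flat-decompose (m ∷ ms) U zero a =
    _ , linComb (λ k → a (m ↑ʳ k)) rest , linComb-++ a (U zero) rest ,
    λ x x⊥U → ∙-linComb-≈0 x (λ k → a (m ↑ʳ k)) rest
      (flat-all⁺ (λ w → x ∙ w ≈ 0#) ms (λ i → U (suc i)) λ j → x⊥U (suc j) λ ())
    where rest = flat ms (λ i → U (suc i))
  flat-decompose (m ∷ ms) U (suc i) a with flat-decompose ms (λ i → U (suc i)) i (λ k → a (m ↑ʳ k))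
  ... | b , r , eq , r⊥ = b , x₀ +ᵛ r ,
    (λ l → begin-equality
      linComb a (flat (m ∷ ms) U) l          ≈⟨ linComb-++ a (U zero) (flat ms (λ i → U (suc i))) l ⟩
      x₀ l + linComb (λ k → a (m ↑ʳ k)) (flat ms (λ i → U (suc i))) l ≈⟨ +-congˡ (eq l) ⟩
      x₀ l + (linComb b (U (suc i)) l + r l)
        ≈⟨ solve 3 (λ x y z → x :+ (y :+ z) := y :+ (x :+ z)) refl (x₀ l) (linComb b (U (suc i)) l) (r l) ⟩
      linComb b (U (suc i)) l + (x₀ l + r l) ∎) ,
    λ x x⊥U → begin-equality
      x ∙ (x₀ +ᵛ r)     ≈⟨ ∙-distribˡ x x₀ r ⟩
      x ∙ x₀ + x ∙ r    ≈⟨ +-cong (∙-linComb-≈0 x (λ k → a (k ↑ˡ ListAction.sum ms)) (U zero) (x⊥U zero λ ()))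
                             (r⊥ x λ j j≢i → x⊥U (suc j) λ sj≡si → j≢i (Finₚ.suc-injective sj≡si)) ⟩
      0# + 0#           ≈⟨ +-identityˡ 0# ⟩
      0#                ∎
    where x₀ = linComb (λ k → a (k ↑ˡ ListAction.sum ms)) (U zero)

  -- Families of eigenvectors and the dimension count.

  distinct : ∀ {q} (ev : Vector Carrier q) → (∀ {i j} → i Fin.< j → ev i < ev j) → ∀ {i j} → i ≢ j → ¬ (ev i ≈ ev j)
  distinct ev increasing {i} {j} i≢j evi≈evj with ℕₚ.<-cmp (Fin.toℕ i) (Fin.toℕ j)
  ... | tri< i<j _ _ = irrefl evi≈evj (increasing i<j)
  ... | tri≈ _ i≡j _ = i≢j (Finₚ.toℕ-injective i≡j)
  ... | tri> _ _ j<i = irrefl (sym evi≈evj) (increasing j<i)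

  -- Shared by both directions: given complete eigenspaces, the sizes must add up to `n`; given
  -- sizes adding up to `n`, the eigenspaces are complete. Vectors within a block need only be
  -- independent, not orthogonal.
  module EigenFamily {n : ℕ} {A : Matrix n} (A-sym : Symmetric A) (ms : List ℕ)
    (ev : Vector Carrier (length ms)) (increasing : ∀ {i j} → i Fin.< j → ev i < ev j)
    (U : Family (Vector Carrier n) ms) (U-eigen : ∀ i k → InEigenspace A (ev i) (U i k))
    (U-independent : ∀ i → LinearlyIndependent (U i))
    where

    private
      eigenvector-⊥-block : ∀ {μ} x → InEigenspace A μ x → ∀ j → ¬ (μ ≈ ev j) → x ⊥ U j
      eigenvector-⊥-block x Ax j μ≉evj k = eigenspaces-orthogonal A-sym μ≉evj {x} {U j k} Ax (U-eigen j k)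

    basis : Vector (Vector Carrier n) (ListAction.sum ms)
    basis = flat ms U

    basis-independent : LinearlyIndependent basis
    basis-independent = flat-independent ms U U-independent λ i j i≢j k →
      eigenvector-⊥-block (U i k) (U-eigen i k) j (distinct ev increasing i≢j)

    sum≤n : ListAction.sum ms ℕ.≤ n
    sum≤n = independent⇒≤ basis basis-independent

    ⊥-basis-invariant : ∀ x → x ⊥ basis → (A · x) ⊥ basis
    ⊥-basis-invariant x x⊥basis = flat-all⁺ (λ w → (A · x) ∙ w ≈ 0#) ms U λ i k → begin-equality
      (A · x) ∙ U i k      ≈⟨ ·-adjoint A-sym x (U i k) ⟨
      x ∙ (A · U i k)      ≈⟨ ∙-congˡ x (U-eigen i k) ⟩
      x ∙ (ev i *ᵛ U i k)  ≈⟨ ∙-*ʳ x (ev i) (U i k) ⟩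
      ev i * x ∙ U i k     ≈⟨ *-congˡ (flat-all⁻ (λ w → x ∙ w ≈ 0#) ms U x⊥basis i k) ⟩
      ev i * 0#            ≈⟨ zeroʳ (ev i) ⟩
      0#                   ∎

    -- If vectors were missing, the eigenvector found in the complement would belong to a listed
    -- eigenvalue. It would then lie in the span of a block to which it is orthogonal.
    n≤sum : ∀ {t} → (∀ x → t * x ∙ x ≤ x ∙ (A · x)) →
            (∀ μ → IsEigenvalue A μ → ∃[ i ] μ ≈ ev i) →
            (∀ i x → InEigenspace A (ev i) x → ∃[ a ] x ≋ linComb a (U i)) →
            n ℕ.≤ ListAction.sum ms
    n≤sum {t} t-bound all-eigenvalues spanning = ℕₚ.≮⇒≥ impossible
      where
      impossible : ¬ (ListAction.sum ms ℕ.< n)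
      impossible sum<n =
        let s , x , x≉0 , x⊥basis , Ax≋sx =
              eigenvector-⊥ {A = A} A-sym {t} t-bound sum<n {basis} basis-independent ⊥-basis-invariant
            i , s≈evi = all-eigenvalues s (x , x≉0 , Ax≋sx)
            a , x≋aU = spanning i x λ j → trans (Ax≋sx j) (*-congʳ s≈evi)
        in x≉0 (x∙x≈0⇒x≋0 {x = x} (trans (∙-congˡ x x≋aU)
             (∙-linComb-≈0 x a (U i) (flat-all⁻ (λ w → x ∙ w ≈ 0#) ms U x⊥basis i))))

    module _ (sum≡n : ListAction.sum ms ≡ n) where

      private
        basis-spanning : ∀ x → ∃[ a ] x ≋ linComb a basis
        basis-spanning = lemma sum≡n basis basis-independent
          where
          -- The length is a variable here, so that the equation with `n` can be matched.
          lemma : ∀ {m} → m ≡ n → (v : Vector (Vector Carrier n) m) → LinearlyIndependent v →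
                  ∀ x → ∃[ a ] x ≋ linComb a v
          lemma ≡.refl = independent⇒spanning

        -- An eigenvector for an unlisted value is orthogonal to every block, hence to a spanning
        -- family, hence to itself.
        eigenvalue-listed : ∀ μ → IsEigenvalue A μ → ∃[ i ] μ ≈ ev i
        eigenvalue-listed μ (x , x≉0 , Ax≋μx) with any? (λ i → μ ≟ ev i)
        ... | yes listed = listed
        ... | no  unlisted = contradiction x≋0 x≉0
          where
          x⊥basis : x ⊥ basis
          x⊥basis = flat-all⁺ (λ w → x ∙ w ≈ 0#) ms U λ i →
            eigenvector-⊥-block x Ax≋μx i λ μ≈evi → unlisted (i , μ≈evi)
          x≋0 : x ≋ 0ᵛ
          x≋0 = let a , x≋ab = basis-spanning x in
            x∙x≈0⇒x≋0 {x = x} (trans (∙-congˡ x x≋ab) (∙-linComb-≈0 x a basis x⊥basis))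

        -- With x = b·Uᵢ + r, the rest r is an eigenvector for evᵢ but is composed of other eigenvectors.
        block-spanning : ∀ i x → InEigenspace A (ev i) x → ∃[ b ] x ≋ linComb b (U i)
        block-spanning i x Ax = b , λ l → begin-equality
          x l                         ≈⟨ x≋ l ⟩
          y l + r l                   ≈⟨ +-congˡ (x∙x≈0⇒x≋0 {x = r} r∙r≈0 l) ⟩
          y l + 0#                    ≈⟨ +-identityʳ _ ⟩
          y l                         ∎
          where
          coefficients = basis-spanning x
          decomposition = flat-decompose ms U i (proj₁ coefficients)
          b = proj₁ decomposition
          r = proj₁ (proj₂ decomposition)
          y = linComb b (U i)
          x≋ : x ≋ y +ᵛ r
          x≋ l = trans (proj₂ coefficients l) (proj₁ (proj₂ (proj₂ decomposition)) l)
          Ay : InEigenspace A (ev i) y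
          Ay = inEigenspace-linComb b (U i) (U-eigen i)
          Ar : InEigenspace A (ev i) r
          Ar l = begin-equality
            (A · r) l                        ≈⟨ solve 2 (λ y r → r := (y :+ r) :- y) refl ((A · y) l) ((A · r) l) ⟩
            ((A · y) l + (A · r) l) - (A · y) l ≈⟨ +-congʳ (∙-distribˡ (A l) y r) ⟨
            (A · (y +ᵛ r)) l - (A · y) l     ≈⟨ +-cong (·-cong A x≋ l) (-‿cong (sym (Ay l))) ⟨
            (A · x) l - ev i * y l           ≈⟨ +-congʳ (trans (Ax l) (*-congˡ (x≋ l))) ⟩
            ev i * (y l + r l) - ev i * y l
              ≈⟨ solve 3 (λ e y r → e :* (y :+ r) :- e :* y := e :* r) refl (ev i) (y l) (r l) ⟩
            ev i * r l                       ∎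
          r∙r≈0 : r ∙ r ≈ 0#
          r∙r≈0 = proj₂ (proj₂ (proj₂ decomposition)) r λ j j≢i →
            eigenvector-⊥-block r Ar j λ evi≈evj → distinct ev increasing j≢i (sym evi≈evj)

      isOrderedMultiplicityList : All (λ m → m ℕ.≥ 1) ms → IsOrderedMultiplicityList A ms
      isOrderedMultiplicityList ms≥1 = record
        { eigenvalue     = ev
        ; increasing     = increasing
        -- Positivity of the multiplicity provides a first vector of the block; independence makes
        -- it nonzero.
        ; isEigenvalue   = λ i → let k = Fin.fromℕ< (All.lookup ms≥1 (∈-lookup i)) in U i k , U≉0 i k , U-eigen i k
        ; allEigenvalues = eigenvalue-listed
        ; multiplicity   = λ i → record
          { basis       = U i
          ; inW         = U-eigen i
          ; independent = U-independent i
          ; spanning    = block-spanning i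
          }
        }
        where
        U≉0 : ∀ i k → ¬ (U i k ≋ 0ᵛ)
        U≉0 i k Uik≋0 = 0≉1 (sym (trans (sym (unit-diagonal k)) (U-independent i (unit k) (λ l → begin-equality
          linComb (unit k) (U i) l  ≈⟨ ∙-comm (unit k) (λ j → U i j l) ⟩
          (λ j → U i j l) ∙ unit k  ≈⟨ ∙-unit (λ j → U i j l) k ⟩
          U i k l                   ≈⟨ Uik≋0 l ⟩
          0#                        ∎) k)))

  -- Laplacians of the complete graph.

  1ᵛ : ∀ {n} → Vector Carrier n
  1ᵛ _ = 1#

  1ᵛ≉0 : ∀ {n} → ¬ (1ᵛ {suc n} ≋ 0ᵛ)
  1ᵛ≉0 1≋0 = 0≉1 (sym (1≋0 zero))

  ∙-1ᵛ : ∀ {n} (x : Vector Carrier n) → x ∙ 1ᵛ ≈ sum x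
  ∙-1ᵛ x = sum-cong-≋ λ i → *-identityʳ (x i)

  -- The diagonal formula is replaced by the vanishing of the row sums, in the form in which `1ᵛ` is
  -- visibly an eigenvector for 0.
  record CompleteLaplacian {n : ℕ} (A : Matrix n) : Set ℓ where
    field
      symmetric : Symmetric A
      negative  : ∀ i j → i ≢ j → A i j < 0#
      kernel    : A · 1ᵛ ≋ 0ᵛ

  sum-split-off : ∀ {n} (f : Vector Carrier n) i → sum f ≈ f i + sum (λ k → if does (k Finₚ.≟ i) then 0# else f k)
  sum-split-off {suc n} f i = begin-equality
    sum f                                ≈⟨ sum-remove f ⟩
    f i + sum (removeAt f i)             ≈⟨ +-congˡ (sum-cong-≋ λ k → g-other (punchInᵢ≢i i k)) ⟨
    f i + sum (removeAt g i)             ≈⟨ +-congˡ (+-identityˡ _) ⟨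
    f i + (0# + sum (removeAt g i))      ≈⟨ +-congˡ (+-congʳ g-same) ⟨
    f i + (g i + sum (removeAt g i))     ≈⟨ +-congˡ (sum-remove g) ⟨
    f i + sum g                          ∎
    where
    g : Vector Carrier (suc n)
    g k = if does (k Finₚ.≟ i) then 0# else f k
    g-same : g i ≈ 0#
    g-same rewrite dec-true (i Finₚ.≟ i) ≡.refl = refl
    g-other : ∀ {k} → k ≢ i → g k ≈ f k
    g-other {k} k≢i rewrite dec-false (k Finₚ.≟ i) k≢i = refl

  𝓢ᴸ⇒CompleteLaplacian : ∀ {n} {A : Matrix n} → 𝓢ᴸ (K n) A → CompleteLaplacian A
  𝓢ᴸ⇒CompleteLaplacian {A = A} A∈𝓢 = record
    { symmetric = symmetric
    ; negative  = edge
    ; kernel    = λ i → begin-equality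
        (A · 1ᵛ) i                                                        ≈⟨ ∙-1ᵛ (A i) ⟩
        sum (A i)                                                         ≈⟨ sum-split-off (A i) i ⟩
        A i i + sum (λ k → if does (k Finₚ.≟ i) then 0# else A i k)       ≈⟨ +-congʳ (diagonal i) ⟩
        - sum (λ k → if does (k Finₚ.≟ i) then 0# else A i k)
          + sum (λ k → if does (k Finₚ.≟ i) then 0# else A i k)           ≈⟨ -‿inverseˡ _ ⟩
        0#                                                                ∎
    }
    where open 𝓢ᴸ A∈𝓢

  CompleteLaplacian⇒𝓢ᴸ : ∀ {n} {A : Matrix n} → CompleteLaplacian A → 𝓢ᴸ (K n) A
  CompleteLaplacian⇒𝓢ᴸ {A = A} laplacian = record
    { symmetric = symmetric
    ; edge      = negative
    ; nonEdge   = λ i j i≢j ¬i≢j → contradiction i≢j ¬i≢j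
    ; diagonal  = λ i → let rest = sum (λ k → if does (k Finₚ.≟ i) then 0# else A i k) in begin-equality
        A i i                    ≈⟨ solve 2 (λ a r → a := (a :+ r) :- r) refl (A i i) rest ⟩
        (A i i + rest) - rest    ≈⟨ +-congʳ (sum-split-off (A i) i) ⟨
        sum (A i) - rest         ≈⟨ +-congʳ (trans (sym (∙-1ᵛ (A i))) (kernel i)) ⟩
        0# - rest                ≈⟨ +-identityˡ _ ⟩
        - rest                   ∎
    }
    where open CompleteLaplacian laplacian

  -- The quadratic form of a Laplacian as a sum over edges.

  module LaplacianForm {n : ℕ} {A : Matrix n} (laplacian : CompleteLaplacian A) where

    open CompleteLaplacian laplacian

    energy : Vector Carrier n → Fin n → Fin n → Carrier
    energy x i j = - A i j * ((x i - x j) * (x i - x j))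

    energy-nonneg : ∀ x i j → 0# ≤ energy x i j
    energy-nonneg x i j with i Finₚ.≟ j
    -- Nothing is known about the sign of the diagonal entry, but the square is zero.
    ... | yes ≡.refl = inj₂ (solve 2 (λ a x → :0 := :- a :* ((x :- x) :* (x :- x))) refl (A i i) (x i))
    ... | no  i≢j    = *-nonneg (inj₁ (x<0⇒0<-x (negative i j i≢j))) (square-nonneg (x i - x j))

    -- Each edge is counted in both directions, hence the factor 2. Of the expanded square only the
    -- mixed term survives: the squares of `x i` cancel by the row sums, those of `x j` by the
    -- column sums, which vanish by symmetry.
    sum-energy : ∀ x → sum (λ i → sum (λ j → energy x i j)) ≈ (1# + 1#) * x ∙ (A · x)
    sum-energy x = begin-equality
      sum (λ i → sum (λ j → energy x i j))
        ≈⟨ sum-cong-≋ row ⟩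
      sum (λ i → (1# + 1#) * (x i * (A · x) i) + - 1# * (1# * (A · x²) i))
        ≈⟨ ∑-distrib-+ (λ i → (1# + 1#) * (x i * (A · x) i)) (λ i → - 1# * (1# * (A · x²) i)) ⟩
      sum (λ i → (1# + 1#) * (x i * (A · x) i)) + sum (λ i → - 1# * (1# * (A · x²) i))
        ≈⟨ +-cong (*-distribˡ-sum (1# + 1#) (λ i → x i * (A · x) i)) (*-distribˡ-sum (- 1#) (λ i → 1# * (A · x²) i)) ⟨
      (1# + 1#) * x ∙ (A · x) + - 1# * 1ᵛ ∙ (A · x²)
        ≈⟨ +-congˡ (trans (*-congˡ 1∙Ax²≈0) (zeroʳ (- 1#))) ⟩
      (1# + 1#) * x ∙ (A · x) + 0#
        ≈⟨ +-identityʳ _ ⟩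
      (1# + 1#) * x ∙ (A · x) ∎
      where
      x² : Vector Carrier n
      x² i = x i * x i
      1∙Ax²≈0 : 1ᵛ ∙ (A · x²) ≈ 0#
      1∙Ax²≈0 = begin-equality
        1ᵛ ∙ (A · x²)  ≈⟨ ·-adjoint symmetric 1ᵛ x² ⟩
        (A · 1ᵛ) ∙ x²  ≈⟨ ∙-comm (A · 1ᵛ) x² ⟩
        x² ∙ (A · 1ᵛ)  ≈⟨ ∙-congˡ x² kernel ⟩
        x² ∙ 0ᵛ        ≈⟨ ∙-zeroʳ x² ⟩
        0#             ∎
      row : ∀ i → sum (λ j → energy x i j) ≈ (1# + 1#) * (x i * (A · x) i) + - 1# * (1# * (A · x²) i)
      row i = begin-equality
        sum (λ j → energy x i j)
          ≈⟨ sum-cong-≋ (λ j → solve 3 (λ a x y → :- a :* ((x :- y) :* (x :- y))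
               := a :* ((:1 :+ :1) :* x :* y :+ (:- :1 :* (y :* y) :+ (:- (x :* x)) :* :1)))
               refl (A i j) (x i) (x j)) ⟩
        A i ∙ (((1# + 1#) * x i) *ᵛ x +ᵛ (- 1# *ᵛ x² +ᵛ - x² i *ᵛ 1ᵛ))
          ≈⟨ trans (∙-distribˡ (A i) (((1# + 1#) * x i) *ᵛ x) (- 1# *ᵛ x² +ᵛ - x² i *ᵛ 1ᵛ))
                   (+-cong (∙-*ʳ (A i) ((1# + 1#) * x i) x)
                           (trans (∙-distribˡ (A i) (- 1# *ᵛ x²) (- x² i *ᵛ 1ᵛ))
                                  (+-cong (∙-*ʳ (A i) (- 1#) x²) (∙-*ʳ (A i) (- x² i) 1ᵛ)))) ⟩
        (1# + 1#) * x i * (A · x) i + (- 1# * (A · x²) i + - x² i * (A · 1ᵛ) i)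
          ≈⟨ +-congˡ (+-congˡ (*-congˡ (kernel i))) ⟩
        (1# + 1#) * x i * (A · x) i + (- 1# * (A · x²) i + - x² i * 0#)
          ≈⟨ solve 4 (λ x a b c → (:1 :+ :1) :* x :* a :+ (:- :1 :* b :+ :- c :* :0)
                         := (:1 :+ :1) :* (x :* a) :+ :- :1 :* (:1 :* b)) refl (x i) ((A · x) i) ((A · x²) i) (x² i) ⟩
        (1# + 1#) * (x i * (A · x) i) + - 1# * (1# * (A · x²) i) ∎

    form-nonneg : ∀ x → 0# ≤ x ∙ (A · x)
    form-nonneg x = *-cancelˡ-nonneg (<-+-≤ 0<1 (inj₁ 0<1))
      (≤-respʳ (sum-energy x) (sum-nonneg λ i → sum-nonneg (energy-nonneg x i)))

    eigenvalue-nonneg : ∀ {μ} → IsEigenvalue A μ → 0# ≤ μ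
    eigenvalue-nonneg {μ} (x , x≉0 , Ax≋μx) = *-cancelˡ-nonneg (∙-positive {x = x} x≉0)
      (≤-respʳ (trans (trans (∙-congˡ x Ax≋μx) (∙-*ʳ x μ x)) (*-comm μ (x ∙ x))) (form-nonneg x))

    -- Vanishing total energy makes every single term vanish. Any two vertices are adjacent, so they
    -- can be compared directly, without a path between them.
    kernel-constant : ∀ x → A · x ≋ 0ᵛ → ∀ i j → x i ≈ x j
    kernel-constant x Ax≋0 i j with i Finₚ.≟ j
    ... | yes ≡.refl = refl
    ... | no  i≢j    = x-y≈0⇒x≈y (square≈0⇒≈0 (*-cancelˡ-≈0 -Aij≉0 energy≈0))
      where
      -Aij≉0 : ¬ (- A i j ≈ 0#)
      -Aij≉0 eq = irrefl (sym eq) (x<0⇒0<-x (negative i j i≢j))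
      energy≈0 : energy x i j ≈ 0#
      energy≈0 = sum-nonneg-≈0 (energy-nonneg x i) (sum-nonneg-≈0 (λ i → sum-nonneg (energy-nonneg x i))
        (trans (sum-energy x) (trans (*-congˡ (trans (∙-congˡ x Ax≋0) (∙-zeroʳ x))) (zeroʳ _))) i) j

  -- Necessity of the conditions on an attained list.

  -- An empty basis cannot produce `1ᵛ`. Kernel vectors are constant, so a relation among their
  -- first coordinates, which exists as soon as there are two of them, is a relation among the
  -- vectors.
  kernel-dimension : ∀ {n} {A : Matrix (suc n)} → CompleteLaplacian A →
                     ∀ {μ m} → 0# ≈ μ → HasMultiplicity A μ m → m ≡ 1
  kernel-dimension {A = A} laplacian {μ} {m} 0≈μ dimension = ℕₚ.≤-antisym (ℕₚ.≮⇒≥ m≯1) (ℕₚ.≮⇒≥ m≮1)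
    where
    open CompleteLaplacian laplacian
    open LaplacianForm laplacian
    open HasDimension dimension
    A1≋μ1 : InEigenspace A μ 1ᵛ
    A1≋μ1 i = trans (kernel i) (trans 0≈μ (sym (*-identityʳ μ)))
    m≮1 : ¬ (m ℕ.< 1)
    m≮1 (s≤s ℕ.z≤n) = 0≉1 (sym (proj₂ (spanning 1ᵛ A1≋μ1) zero))
    constant : ∀ k i → basis k i ≈ basis k zero
    constant k i = kernel-constant (basis k)
      (λ j → trans (inW k j) (trans (*-congʳ (sym 0≈μ)) (zeroˡ (basis k j)))) i zero
    m≯1 : ¬ (1 ℕ.< m)
    m≯1 1<m =
      let a , relation , k , ak≉0 = dependent {n = 1} 1<m (λ k _ → basis k zero)
      in ak≉0 (independent a (λ i → trans (sum-cong-≋ λ k → *-congˡ (constant k i)) (relation zero)) k)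

  dimension-positive : ∀ {n} {A : Matrix n} {μ m} → IsEigenvalue A μ → HasMultiplicity A μ m → m ℕ.≥ 1
  dimension-positive {m = zero}  (x , x≉0 , Ax) dimension =
    contradiction (proj₂ (HasDimension.spanning dimension x Ax)) x≉0
  dimension-positive {m = suc m} _              _         = s≤s ℕ.z≤n

  attained⇒admissible : ∀ {n} ms → Attains (K (suc n)) ms →
                        All (λ m → m ℕ.≥ 1) ms × List.head ms ≡ just 1 × ListAction.sum ms ≡ suc n
  attained⇒admissible {n} ms (A , A∈𝓢 , list) = ms≥1 , head≡1 ms list , sum≡n
    where
    laplacian = 𝓢ᴸ⇒CompleteLaplacian A∈𝓢
    open CompleteLaplacian laplacian
    open LaplacianForm laplacian
    open IsOrderedMultiplicityList list
    open module M i = HasDimension (multiplicity i)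
    open EigenFamily symmetric ms eigenvalue increasing basis inW independent using (sum≤n; n≤sum)

    sum≡n : ListAction.sum ms ≡ suc n
    sum≡n = ℕₚ.≤-antisym sum≤n (n≤sum {0#} form-bound allEigenvalues spanning)
      where
      form-bound : ∀ x → 0# * x ∙ x ≤ x ∙ (A · x)
      form-bound x = begin
        0# * x ∙ x   ≈⟨ zeroˡ (x ∙ x) ⟩
        0#           ≤⟨ form-nonneg x ⟩
        x ∙ (A · x)  ∎

    ms≥1 : All (λ m → m ℕ.≥ 1) ms
    ms≥1 = All.tabulate λ m∈ms → ≡.subst (ℕ._≥ 1) (≡.sym (lookup-index m∈ms))
      (dimension-positive {A = A} (isEigenvalue (index m∈ms)) (multiplicity (index m∈ms)))

    -- The value 0 occurs in the list; at a later position it would be preceded by a negative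
    -- eigenvalue.
    head≡1 : ∀ ms → IsOrderedMultiplicityList A ms → List.head ms ≡ just 1
    head≡1 ms list with IsOrderedMultiplicityList.allEigenvalues list 0#
                          (1ᵛ , 1ᵛ≉0 , λ i → trans (kernel i) (sym (zeroˡ 1#)))
    head≡1 (m ∷ ms) list | zero  , 0≈ev = ≡.cong just
      (kernel-dimension laplacian 0≈ev (IsOrderedMultiplicityList.multiplicity list zero))
    head≡1 (m ∷ ms) list | suc i , 0≈ev = contradiction
      (eigenvalue-nonneg (IsOrderedMultiplicityList.isEigenvalue list zero))
      (<⇒≱ (<-respʳ (sym 0≈ev) (IsOrderedMultiplicityList.increasing list {zero} {suc i} (s≤s ℕ.z≤n))))

  -- Joining new vertices to a complete graph.

  -- The image of a natural number in the field, written as the sum that appears when a row is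
  -- applied to `1ᵛ`.
  ν : ℕ → Carrier
  ν n = sum {n} 1ᵛ

  sum-const : ∀ n x → sum {n} (λ _ → x) ≈ ν n * x
  sum-const n x = trans (sum-cong-≋ {n} λ _ → sym (*-identityˡ x)) (sym (*-distribʳ-sum {n} x 1ᵛ))

  ν-nonneg : ∀ n → 0# ≤ ν n
  ν-nonneg n = sum-nonneg {n} λ _ → inj₁ 0<1

  sum-unit : ∀ {n} (i : Fin n) → sum (unit i) ≈ 1#
  sum-unit i = trans (sum-cong-≋ λ j → sym (*-identityˡ (unit i j))) (∙-unit 1ᵛ i)

  -- Joining m new vertices to each other and to all N old ones by edges of weight w
  -- creates the eigenvalue T = (m + N) w with multiplicity m, and raises each
  -- nonzero eigenvalue of A by m w.
  module Join {N : ℕ} {A : Matrix N} (laplacian : CompleteLaplacian A) (m : ℕ) {w : Carrier} (0<w : 0# < w) where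

    open CompleteLaplacian laplacian

    T : Carrier
    T = (ν m + ν N) * w

    -- On the diagonal `T - w` is the weighted degree of a new vertex, which has `m + N - 1` edges
    -- of weight `w`; each old vertex gains degree `ν m * w`.
    entry : Fin m ⊎ Fin N → Fin m ⊎ Fin N → Carrier
    entry (inj₁ i) (inj₁ j) = T * unit i j - w
    entry (inj₁ i) (inj₂ j) = - w
    entry (inj₂ i) (inj₁ j) = - w
    entry (inj₂ i) (inj₂ j) = A i j + ν m * w * unit i j

    J : Matrix (m ℕ.+ N)
    J i j = entry (splitAt m i) (splitAt m j)

    -- The product with `J` in closed form: beyond `A` and diagonal terms it involves only the two
    -- coordinate sums, so each eigenvector check reduces to knowing these.
    image : Vector Carrier m → Vector Carrier N → Fin m ⊎ Fin N → Carrier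
    image x y (inj₁ i) = T * x i - w * (sum x + sum y)
    image x y (inj₂ i) = (A · y) i + ν m * w * y i - w * sum x

    J-· : ∀ x y l → (J · (x ++ y)) l ≈ image x y (splitAt m l)
    J-· x y l = begin-equality
      (J · (x ++ y)) l
        ≈⟨ sum-++ m (λ j → J l j * (x ++ y) j) ⟩
      sum (λ j → J l (j ↑ˡ N) * (x ++ y) (j ↑ˡ N)) + sum (λ j → J l (m ↑ʳ j) * (x ++ y) (m ↑ʳ j))
        ≈⟨ +-cong (sum-cong-≋ λ j → reflexive (≡.cong (λ o → entry s o * [ x , y ]′ o) (splitAt-↑ˡ m j N)))
                  (sum-cong-≋ λ j → reflexive (≡.cong (λ o → entry s o * [ x , y ]′ o) (splitAt-↑ʳ m N j))) ⟩
      sum (λ j → entry s (inj₁ j) * x j) + sum (λ j → entry s (inj₂ j) * y j)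
        ≈⟨ row s ⟩
      image x y s ∎
      where
      s = splitAt m l
      row : ∀ s → sum (λ j → entry s (inj₁ j) * x j) + sum (λ j → entry s (inj₂ j) * y j) ≈ image x y s
      row (inj₁ i) = begin-equality
        sum (λ j → (T * unit i j - w) * x j) + sum (λ j → - w * y j)
          ≈⟨ +-cong (∙-comm (λ j → T * unit i j - w) x) (sym (*-distribˡ-sum (- w) y)) ⟩
        x ∙ (T *ᵛ unit i +ᵛ (λ _ → - w)) + - w * sum y
          ≈⟨ +-congʳ (∙-distribˡ x (T *ᵛ unit i) (λ _ → - w)) ⟩
        (x ∙ (T *ᵛ unit i) + x ∙ (λ _ → - w)) + - w * sum y
          ≈⟨ +-congʳ (+-cong (trans (∙-*ʳ x T (unit i)) (*-congˡ (∙-unit x i))) (sym (*-distribʳ-sum (- w) x))) ⟩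
        (T * x i + sum x * - w) + - w * sum y
          ≈⟨ solve 4 (λ t w a b → (t :+ a :* :- w) :+ :- w :* b := t :- w :* (a :+ b)) refl (T * x i) w (sum x) (sum y) ⟩
        T * x i - w * (sum x + sum y) ∎
      row (inj₂ i) = begin-equality
        sum (λ j → - w * x j) + sum (λ j → (A i j + ν m * w * unit i j) * y j)
          ≈⟨ +-cong (sym (*-distribˡ-sum (- w) x)) (∙-comm (λ j → A i j + ν m * w * unit i j) y) ⟩
        - w * sum x + y ∙ (A i +ᵛ (ν m * w) *ᵛ unit i)
          ≈⟨ +-congˡ (trans (∙-distribˡ y (A i) ((ν m * w) *ᵛ unit i))
               (+-cong (∙-comm y (A i)) (trans (∙-*ʳ y (ν m * w) (unit i)) (*-congˡ (∙-unit y i))))) ⟩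
        - w * sum x + ((A · y) i + ν m * w * y i)
          ≈⟨ solve 3 (λ w a b → :- w :* a :+ b := b :- w :* a) refl w (sum x) _ ⟩
        (A · y) i + ν m * w * y i - w * sum x ∎

    J-eigen : ∀ {μ} x y → (∀ s → image x y s ≈ μ * [ x , y ]′ s) → InEigenspace J μ (x ++ y)
    J-eigen x y eq l = trans (J-· x y l) (eq (splitAt m l))

    J-laplacian : CompleteLaplacian J
    J-laplacian = record
      { symmetric = λ i j → entry-symmetric (splitAt m i) (splitAt m j)
      ; negative  = λ i j i≢j → entry-negative (splitAt m i) (splitAt m j) λ eq →
          i≢j (≡.trans (≡.sym (Finₚ.join-splitAt m N i)) (≡.trans (≡.cong (Fin.join m N) eq) (Finₚ.join-splitAt m N j)))
      ; kernel    = λ l → begin-equality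
          (J · 1ᵛ) l                  ≈⟨ ·-cong J {1ᵛ} {1ᵛ {m} ++ 1ᵛ {N}} (λ l → reflexive (1ᵛ-++ (splitAt m l))) l ⟩
          (J · (1ᵛ {m} ++ 1ᵛ {N})) l  ≈⟨ J-· 1ᵛ 1ᵛ l ⟩
          image 1ᵛ 1ᵛ (splitAt m l)   ≈⟨ image-1 (splitAt m l) ⟩
          0#                          ∎
      }
      where
      1ᵛ-++ : (s : Fin m ⊎ Fin N) → 1# ≡ [ 1ᵛ , 1ᵛ ]′ s
      1ᵛ-++ (inj₁ _) = ≡.refl
      1ᵛ-++ (inj₂ _) = ≡.refl
      entry-symmetric : ∀ s t → entry s t ≈ entry t s
      entry-symmetric (inj₁ i) (inj₁ j) = +-congʳ (*-congˡ (unit-sym j i))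
      entry-symmetric (inj₁ i) (inj₂ j) = refl
      entry-symmetric (inj₂ i) (inj₁ j) = refl
      entry-symmetric (inj₂ i) (inj₂ j) = +-cong (symmetric i j) (*-congˡ (unit-sym j i))
      off-diagonal : ∀ {n} a {x} {i j : Fin n} → i ≢ j → x + a * unit i j ≈ x
      off-diagonal a i≢j = trans
        (+-congˡ (trans (*-congˡ (unit-offDiagonal λ j≡i → i≢j (≡.sym j≡i))) (zeroʳ a)))
        (+-identityʳ _)
      entry-negative : ∀ s t → s ≢ t → entry s t < 0#
      entry-negative (inj₁ i) (inj₁ j) s≢t = <-respˡ
        (sym (trans (+-comm _ (- w)) (off-diagonal T λ i≡j → s≢t (≡.cong inj₁ i≡j))))
        (0<x⇒-x<0 0<w)
      entry-negative (inj₁ i) (inj₂ j) _   = 0<x⇒-x<0 0<w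
      entry-negative (inj₂ i) (inj₁ j) _   = 0<x⇒-x<0 0<w
      entry-negative (inj₂ i) (inj₂ j) s≢t = <-respˡ (sym (off-diagonal (ν m * w) i≢j)) (negative i j i≢j)
        where
        i≢j : i ≢ j
        i≢j i≡j = s≢t (≡.cong inj₂ i≡j)
      image-1 : ∀ s → image 1ᵛ 1ᵛ s ≈ 0#
      image-1 (inj₁ i) = solve 2 (λ n w → n :* w :* :1 :- w :* n := :0) refl (ν m + ν N) w
      image-1 (inj₂ i) = begin-equality
        (A · 1ᵛ) i + ν m * w * 1# - w * ν m ≈⟨ +-congʳ (+-congʳ (kernel i)) ⟩
        0# + ν m * w * 1# - w * ν m         ≈⟨ solve 2 (λ n w → :0 :+ n :* w :* :1 :- w :* n := :0) refl (ν m) w ⟩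
        0#                                  ∎

    -- The weights make the coordinate sum zero, as orthogonality to the constants demands. On the
    -- new vertices the family is `ν N` times the identity, whence its independence.
    newEigenvector : Fin m → Vector Carrier (m ℕ.+ N)
    newEigenvector i = (ν N *ᵛ unit i) ++ (λ _ → - 1#)

    newEigenvector-eigen : ∀ i → InEigenspace J T (newEigenvector i)
    newEigenvector-eigen i = J-eigen x y λ
      { (inj₁ j) → begin-equality
          T * x j - w * (sum x + sum y)          ≈⟨ +-congˡ (-‿cong (*-congˡ (+-cong Σx Σy))) ⟩
          T * x j - w * (ν N + ν N * - 1#)
            ≈⟨ solve 3 (λ t w n → t :- w :* (n :+ n :* :- :1) := t) refl (T * x j) w (ν N) ⟩
          T * x j                                ∎
      ; (inj₂ j) → begin-equality
          (A · y) j + ν m * w * - 1# - w * sum x  ≈⟨ +-cong (+-congʳ (Ay j)) (-‿cong (*-congˡ Σx)) ⟩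
          0# + ν m * w * - 1# - w * ν N
            ≈⟨ solve 3 (λ m w n → :0 :+ m :* w :* :- :1 :- w :* n := (m :+ n) :* w :* :- :1) refl (ν m) w (ν N) ⟩
          T * - 1#                               ∎ }
      where
      x : Vector Carrier m
      x = ν N *ᵛ unit i
      y : Vector Carrier N
      y _ = - 1#
      Σx : sum x ≈ ν N
      Σx = trans (sym (*-distribˡ-sum (ν N) (unit i))) (trans (*-congˡ (sum-unit i)) (*-identityʳ (ν N)))
      Σy : sum y ≈ ν N * - 1#
      Σy = sum-const N (- 1#)
      Ay : A · y ≋ 0ᵛ
      Ay j = begin-equality
        A j ∙ y               ≈⟨ ∙-congˡ (A j) (λ _ → sym (*-identityʳ (- 1#))) ⟩
        A j ∙ (- 1# *ᵛ 1ᵛ)    ≈⟨ ∙-*ʳ (A j) (- 1#) 1ᵛ ⟩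
        - 1# * (A · 1ᵛ) j     ≈⟨ trans (*-congˡ (kernel j)) (zeroʳ (- 1#)) ⟩
        0#                    ∎

    newEigenvector-independent : ¬ (ν N ≈ 0#) → LinearlyIndependent newEigenvector
    newEigenvector-independent νN≉0 a relation j = *-cancelˡ-≈0 νN≉0 (begin-equality
      ν N * a j                                           ≈⟨ *-congˡ (∙-unit a j) ⟨
      ν N * a ∙ unit j                                    ≈⟨ ∙-*ʳ a (ν N) (unit j) ⟨
      sum (λ k → a k * (ν N * unit j k))                  ≈⟨ sum-cong-≋ (λ k → *-congˡ (trans (*-congˡ (unit-sym k j))
        (reflexive (≡.cong [ ν N *ᵛ unit k , (λ _ → - 1#) ]′ (≡.sym (splitAt-↑ˡ m j N)))))) ⟩
      linComb a newEigenvector (j ↑ˡ N)                   ≈⟨ relation (j ↑ˡ N) ⟩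
      0#                                                  ∎)

    extend : Vector Carrier N → Vector Carrier (m ℕ.+ N)
    extend y = 0ᵛ {m} ++ y

    -- Positivity of `μ` makes `y` orthogonal to the constants, so the new vertices see the
    -- coordinate sum 0. The constant vector of the old graph does not extend in this way.
    extend-eigen : ∀ {μ} → 0# < μ → ∀ y → InEigenspace A μ y → InEigenspace J (μ + ν m * w) (extend y)
    extend-eigen {μ} 0<μ y Ay = J-eigen 0ᵛ y λ
      { (inj₁ i) → begin-equality
          T * 0# - w * (sum {m} 0ᵛ + sum y)  ≈⟨ +-congˡ (-‿cong (*-congˡ (+-cong Σ0 Σy))) ⟩
          T * 0# - w * (0# + 0#)
            ≈⟨ solve 3 (λ t w e → t :* :0 :- w :* (:0 :+ :0) := e :* :0) refl T w (μ + ν m * w) ⟩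
          (μ + ν m * w) * 0#                 ∎
      ; (inj₂ i) → begin-equality
          (A · y) i + ν m * w * y i - w * sum {m} 0ᵛ  ≈⟨ +-cong (+-congʳ (Ay i)) (-‿cong (*-congˡ Σ0)) ⟩
          μ * y i + ν m * w * y i - w * 0#
            ≈⟨ solve 4 (λ e n w z → e :* z :+ n :* w :* z :- w :* :0 := (e :+ n :* w) :* z) refl μ (ν m) w (y i) ⟩
          (μ + ν m * w) * y i                         ∎ }
      where
      Σ0 : sum {m} 0ᵛ ≈ 0#
      Σ0 = sum-zero {m} λ _ → refl
      Σy : sum y ≈ 0#
      Σy = trans (sym (∙-1ᵛ y)) (eigenspaces-orthogonal {A = A} symmetric {μ} {0#} (λ μ≈0 → irrefl (sym μ≈0) 0<μ) {y} {1ᵛ}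
             Ay (λ i → trans (kernel i) (sym (zeroˡ 1#))))

    extend-independent : ∀ {p} (v : Vector (Vector Carrier N) p) → LinearlyIndependent v →
                         LinearlyIndependent (λ k → extend (v k))
    extend-independent v v-independent a relation = v-independent a λ i → trans
      (sum-cong-≋ λ k → *-congˡ (reflexive (≡.cong [ 0ᵛ , v k ]′ (≡.sym (splitAt-↑ʳ m N i)))))
      (relation (m ↑ʳ i))

  -- Realising a prescribed list.

  -- Here `ms` lists multiplicities of nonzero eigenvalues only; 0 is adjoined at the very end.
  -- Completeness of the eigenspaces is not recorded, as it follows from the final count.
  record Realisation (b : Carrier) (ms : List ℕ) (N : ℕ) : Set (c ⊔ ℓ) where
    field
      matrix      : Matrix N
      laplacian   : CompleteLaplacian matrix
      eigenvalue  : Vector Carrier (length ms)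
      increasing  : ∀ {i j} → i Fin.< j → eigenvalue i < eigenvalue j
      bounded     : ∀ i → b < eigenvalue i
      basis       : Family (Vector Carrier N) ms
      eigen       : ∀ i k → InEigenspace matrix (eigenvalue i) (basis i k)
      independent : ∀ i → LinearlyIndependent (basis i)

  -- The bound on the old eigenvalues is `ν N * w`, just what puts `T` below the raised ones. Since
  -- `N` is at least 1, `T` is at least `w = 1 + b` and so exceeds `b`.
  join-realisation : ∀ {b ms N} → 0# ≤ b → 0# ≤ ν N - 1# → ∀ m →
                     Realisation (ν N * (1# + b)) ms N → Realisation b (m ∷ ms) (m ℕ.+ N)
  join-realisation {b} {ms} {N} 0≤b 1≤νN m r = record
    { matrix      = J
    ; laplacian   = J-laplacian
    ; eigenvalue  = T ∷ᵛ (λ i → eigenvalue i + ν m * w)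
    ; increasing  = λ { {zero} {suc j} _ → T<raised j
                      ; {suc i} {suc j} (s≤s i<j) → +-monoˡ-< (ν m * w) (increasing i<j) }
    ; bounded     = λ { zero → b<T ; (suc i) → <-trans b<T (T<raised i) }
    ; basis       = λ { zero → newEigenvector ; (suc i) k → extend (basis i k) }
    ; eigen       = λ { zero → newEigenvector-eigen ; (suc i) k → extend-eigen (0<eigenvalue i) (basis i k) (eigen i k) }
    ; independent = λ { zero → newEigenvector-independent νN≉0 ; (suc i) → extend-independent (basis i) (independent i) }
    }
    where
    open Realisation r
    w = 1# + b
    0<w : 0# < w
    0<w = <-+-≤ 0<1 0≤b
    open Join laplacian m 0<w
    νN≉0 : ¬ (ν N ≈ 0#)
    νN≉0 νN≈0 = <⇒≱ (0<x⇒-x<0 0<1) (≤-respʳ (trans (+-congʳ νN≈0) (+-identityˡ (- 1#))) 1≤νN)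
    0<eigenvalue : ∀ i → 0# < eigenvalue i
    0<eigenvalue i = begin-strict
      0#           ≤⟨ *-nonneg (ν-nonneg N) (inj₁ 0<w) ⟩
      ν N * w      <⟨ bounded i ⟩
      eigenvalue i ∎
    T<raised : ∀ i → T < eigenvalue i + ν m * w
    T<raised i = begin-strict
      T                        ≈⟨ solve 3 (λ m n w → (m :+ n) :* w := n :* w :+ m :* w) refl (ν m) (ν N) w ⟩
      ν N * w + ν m * w        <⟨ +-monoˡ-< (ν m * w) (bounded i) ⟩
      eigenvalue i + ν m * w   ∎
    b<T : b < T
    b<T = 0<y-x⇒x<y (<-respʳ
      (solve 3 (λ m n b → :1 :+ ((n :- :1) :* (:1 :+ b) :+ m :* (:1 :+ b)) := (m :+ n) :* (:1 :+ b) :- b)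
        refl (ν m) (ν N) b)
      (<-+-≤ 0<1 (+-nonneg (*-nonneg 1≤νN (inj₁ 0<w)) (*-nonneg (ν-nonneg m) (inj₁ 0<w)))))

  -- The bound varies through the recursion, growing towards the end of the list. A single vertex
  -- has no nonzero eigenvalue and satisfies every bound.
  realise : ∀ ms {b} → 0# ≤ b → Realisation b ms (suc (ListAction.sum ms))
  realise [] _ = record
    { matrix      = λ _ _ → 0#
    ; laplacian   = record
      { symmetric = λ _ _ → refl
      ; negative  = λ { zero zero 0≢0 → contradiction ≡.refl 0≢0 }
      ; kernel    = λ _ → trans (+-identityʳ _) (zeroˡ 1#)
      }
    ; eigenvalue  = λ ()
    ; increasing  = λ { {()} }
    ; bounded     = λ ()
    ; basis       = λ ()
    ; eigen       = λ ()
    ; independent = λ ()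
    }
  realise (m ∷ ms) {b} 0≤b = ≡.subst (Realisation b (m ∷ ms)) (ℕₚ.+-suc m (ListAction.sum ms))
    (join-realisation 0≤b 1≤ν m (realise ms (*-nonneg (ν-nonneg (suc (ListAction.sum ms))) (+-nonneg (inj₁ 0<1) 0≤b))))
    where
    1≤ν : 0# ≤ ν (suc (ListAction.sum ms)) - 1#
    1≤ν = ≤-respʳ (solve 1 (λ n → n := (:1 :+ n) :- :1) refl (ν (ListAction.sum ms))) (ν-nonneg (ListAction.sum ms))

  -- The bound 0 suffices at the outermost stage: it puts the eigenvalue 0, with `1ᵛ` as its block,
  -- in front of all others.
  admissible⇒attained : ∀ ms → All (λ m → m ℕ.≥ 1) (1 ∷ ms) → Attains (K (suc (ListAction.sum ms))) (1 ∷ ms)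
  admissible⇒attained ms ms≥1 = matrix , CompleteLaplacian⇒𝓢ᴸ laplacian ,
    EigenFamily.isOrderedMultiplicityList (CompleteLaplacian.symmetric laplacian) (1 ∷ ms)
      (0# ∷ᵛ eigenvalue)
      (λ { {zero} {suc j} _ → bounded j ; {suc i} {suc j} (s≤s i<j) → increasing i<j })
      (λ { zero _ → 1ᵛ ; (suc i) → basis i })
      (λ { zero _ i → trans (CompleteLaplacian.kernel laplacian i) (sym (zeroˡ 1#)) ; (suc i) → eigen i })
      (λ { zero a relation zero → trans (sym (trans (+-identityʳ _) (*-identityʳ (a zero)))) (relation zero)
         ; (suc i) → independent i })
      ≡.refl ms≥1
    where open Realisation (realise ms ≤-refl)

open import Data.List.Base using (head; sum)
open import Data.Nat.Base using (NonZero; _≥_)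

theorem3p3 : {c ℓ : Level} (ℝ : CompleteOrderedField c ℓ) (n : ℕ) .{{_ : NonZero n}} (ms : List ℕ) →
    Spectral.Attains ℝ (K n) ms ⇔ (All (λ m → m ≥ 1) ms × head ms ≡ just 1 × sum ms ≡ n)
theorem3p3 ℝ (suc n) ms = mk⇔ (CompleteGraph.attained⇒admissible ℝ ms) (attain ms)
  where
  attain : ∀ ms → All (λ m → m ≥ 1) ms × head ms ≡ just 1 × sum ms ≡ suc n → Spectral.Attains ℝ (K (suc n)) ms
  attain (1 ∷ ms) (ms≥1 , ≡.refl , ≡.refl) = CompleteGraph.admissible⇒attained ℝ ms ms≥1
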